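{- Let $T$ be an $n$-tournament with $n\ge 2$. Then: (i) $T\in\mathcal{D}_1$ if and only if $T$ is switching equivalent to a transitive blowup of $L_2$; (ii) $T\in\mathcal{D}_3\setminus\mathcal{D}_1$ if and only if $T$ is switching equivalent to a transitive blowup of $L_4$; (iii) $T\in\mathcal{D}_3$ if and only if $T$ is switching equivalent to a transitive blowup of $L_k$ for some $k\in\{2,4\}$; (iv) $T\in\mathcal{D}_5\setminus\mathcal{D}_3$ if and only if $T$ is switching equivalent to a transitive blowup of $L_6$; (v) $T\in\mathcal{D}_5$ if and only if $T$ is switching equivalent to a transitive blowup of $L_k$ for some $k\in\{2,4,6\}$.
   Context: A tournament is a directed graph with exactly one arc between each pair of distinct vertices; $u\rightarrow v$ means the arc goes from $u$ to $v$; an $n$-tournament has $n$ vertices. For a tournament $T$ on vertices $v_1,\dots,v_n$, its skew-adjacency matrix is the zero-diagonal matrix $S_T=[s_{ij}]$ with $s_{ij}=-s_{ji}=1$ if $v_i\rightarrow v_j$, and $\det(T):=\det(S_T)$. A subtournament of $T$ is the tournament induced by a nonempty vertex subset (including $T$ itself). For a positive odd integer $k$, $\mathcal{D}_k$ is the set of tournaments all of whose subtournaments have determinant at most $k^2$. A tournament is transitive if it has no directed 3-cycle. The switch of $T$ with respect to $W\subseteq V(T)$ is obtained by reversing all arcs between $W$ and $V(T)\setminus W$; switching equivalent means one is a switch of the other. For an $n$-tournament $R$ with vertices $v_1,\dots,v_n$ and positive integers $a_1,\dots,a_n$, the transitive blowup $R(a_1,\dots,a_n)$ replaces each $v_i$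 by a transitive tournament on $a_i$ vertices, with all arcs from the $i$-th block to the $j$-th block whenever $v_i\rightarrow v_j$ in $R$. For $m\ge 2$, $L_m$ is the tournament on vertices $u_1,\dots,u_m$ with $u_i\rightarrow u_j$ for $1\le i<j\le m-1$, and for $1\le i\le m-1$: $u_m\rightarrow u_i$ if $i$ is odd and $u_i\rightarrow u_m$ if $i$ is even. -}

module Defs where

open import Data.Nat as ℕ using (ℕ; zero; suc; _<ᵇ_; _≡ᵇ_; _%_; _∸_)
open import Data.Bool using (Bool; true; false; not; if_then_else_; _xor_; _∧_)
open import Data.Fin using (Fin; toℕ; punchIn; _≟_)
import Data.Fin as Fin
open import Data.Integer as ℤ using (ℤ; +_; -_)
open import Data.Product using (Σ; _,_; _×_)
open import Relation.Binary.PropositionalEquality using (_≡_; _≢_)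
open import Relation.Nullary using (¬_; does)
open import Function.Definitions using (Injective)
open import Function.Bundles using (_⤖_; Bijection)

-- A tournament on vertex set Fin n, given by its arc relation:
-- T i j ≡ true  means  i → j.
Rel : ℕ → Set
Rel n = Fin n → Fin n → Bool

record IsTournament {n : ℕ} (T : Rel n) : Set where
  field
    irrefl : ∀ i → T i i ≡ false
    oneArc : ∀ i j → i ≢ j → T i j ≡ not (T j i)

skew : ∀ {n} → Rel n → Fin n → Fin n → ℤ
skew T i j = if T i j then + 1 else (if T j i then - (+ 1) else + 0)

sumFin : ∀ n → (Fin n → ℤ) → ℤ
sumFin zero    f = + 0
sumFin (suc n) f = f Fin.zero ℤ.+ sumFin n (λ i → f (Fin.suc i))

sgn : ℕ → ℤ
sgn k = if (k % 2) ≡ᵇ 0 then + 1 else - (+ 1)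

det : ∀ n → (Fin n → Fin n → ℤ) → ℤ
det zero    M = + 1
det (suc n) M =
  sumFin (suc n) (λ j → sgn (toℕ j) ℤ.* (M Fin.zero j ℤ.* det n (λ r c → M (Fin.suc r) (punchIn j c))))

detT : ∀ {n} → Rel n → ℤ
detT {n} T = det n (skew T)

-- subtournament induced by a nonempty vertex subset, given by an injective
-- listing f : Fin (suc m) → Fin n of its vertices
sub : ∀ {n m} → Rel n → (Fin m → Fin n) → Rel m
sub T f i j = T (f i) (f j)

InD : ℕ → ∀ {n} → Rel n → Set
InD k {n} T = ∀ m (f : Fin (suc m) → Fin n) → Injective _≡_ _≡_ f →
  detT (sub T f) ℤ.≤ + (k ℕ.* k)

switch : ∀ {n} → Rel n → (Fin n → Bool) → Rel n
switch T W i j = T i j xor (W i xor W j)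

-- the tournament L_m on u_1,…,u_m, represented on Fin m with u_{i} = index i-1
L : ∀ m → Rel m
L m i j =
  let i' = toℕ i ; j' = toℕ j ; last = m ∸ 1 in
  if (i' ≡ᵇ last) ∧ not (j' ≡ᵇ last) then (j' % 2) ≡ᵇ 0        -- u_m → u_(j'+1) iff j'+1 odd
  else if (j' ≡ᵇ last) ∧ not (i' ≡ᵇ last) then (i' % 2) ≡ᵇ 1   -- u_(i'+1) → u_m iff i'+1 even
  else i' <ᵇ j'

BlowupV : ∀ {m} → (Fin m → ℕ) → Set
BlowupV {m} a = Σ (Fin m) (λ i → Fin (a i))

blowup : ∀ {m} → Rel m → (a : Fin m → ℕ) → BlowupV a → BlowupV a → Bool
blowup R a (i , x) (j , y) =
  if does (i ≟ j) then toℕ x <ᵇ toℕ y else R i j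

IsoBlowup : ∀ {n m} → Rel n → Rel m → (Fin m → ℕ) → Set
IsoBlowup {n} T R a =
  Σ (Fin n ⤖ BlowupV a) λ φ →
    ∀ u v → T u v ≡ blowup R a (Bijection.to φ u) (Bijection.to φ v)

SwBlowup : ∀ {n m} → Rel n → Rel m → Set
SwBlowup {n} {m} T R =
  Σ (Fin n → Bool) λ W →
  Σ (Fin m → ℕ) λ a →
    (∀ i → 1 ℕ.≤ a i) × IsoBlowup (switch T W) R a

{-# OPTIONS --safe #-}

-- Determinants of blowups.  Switching conjugates the skew-adjacency matrix by a ±1 diagonal
-- matrix, so it preserves determinants.  If u immediately precedes v in a block, subtracting
-- row and column v from row and column u shows that deleting both vertices preserves the
-- determinant.  Hence every subtournament of a blowup of L k has the determinant of a
-- subtournament of L k, and those are finitely many.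
--
-- Conversely, let T be in D₅.  Switch T so that one vertex dominates the others.  If no cyclic
-- triangle remains, T is a blowup of L 2.  Otherwise T contains a copy of L 4, and every vertex is,
-- up to sign, a twin of exactly one vertex of the copy.  After the corresponding switching, each
-- class of twins is transitive, since a cyclic triangle of twins gives a determinant 81; and the
-- arcs between two classes are those of L 4, since a wrong arc gives a determinant 49 or a copy of
-- L 6.  A copy of L 6 is treated in the same way: a vertex that is no twin, a cyclic triangle and
-- a wrong arc all give a determinant of at least 49.

module Submission where

open import Defs
open import Data.Bool as Bool using (Bool; true; false; not; if_then_else_; _xor_)
import Data.Bool.Properties as Boolₚ
open import Data.Empty using (⊥)
open import Data.Fin as Fin using (Fin; zero; suc; toℕ; punchIn; #_)
import Data.Fin.Properties as Finₚ
open import Data.Fin.Properties using (all?; any?)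
open import Data.Integer as ℤ using (ℤ; +_; -_)
import Data.Integer.Properties as ℤₚ
open import Data.Integer.Tactic.RingSolver using (solve-∀)
open import Data.List as List using (List; []; _∷_)
open import Data.List.Membership.Propositional.Properties using (∈-filter⁺; ∈-allFin)
import Data.List.Relation.Unary.All.Properties as ListAllₚ
import Data.List.Relation.Unary.AllPairs as ListAllPairs
import Data.List.Relation.Unary.Any as ListAny
import Data.List.Relation.Unary.Unique.Propositional.Properties as Uniqueₚ
open import Data.Nat as ℕ using (ℕ; zero; suc; _≤_; _<ᵇ_)
import Data.Nat.Properties as ℕₚ
open import Data.Product using (Σ; ∃; ∃₂; _,_; _×_; proj₁; proj₂)
open import Data.Sum as Sum using (_⊎_; inj₁; inj₂; [_,_]′)
open import Data.Unit using (tt)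
open import Data.Vec as Vec using (Vec; []; _∷_; lookup; tabulate)
import Data.Vec.Functional as VF
open import Data.Vec.Membership.Propositional using (_∈_)
open import Data.Vec.Membership.Propositional.Properties using (∈-fromList⁺)
import Data.Vec.Properties as Vecₚ
open import Data.Vec.Relation.Unary.All as All using (All; []; _∷_)
import Data.Vec.Relation.Unary.All.Properties as Allₚ
open import Data.Vec.Relation.Unary.AllPairs using (AllPairs; []; _∷_)
import Data.Vec.Relation.Unary.AllPairs.Properties as AllPairsₚ
open import Data.Vec.Relation.Unary.Any as Any using (Any; here; there)
import Data.Vec.Relation.Unary.Any.Properties as Anyₚ
open import Function using (_∘_; _on_)
open import Function.Bundles using (_⇔_; mk⇔; mk⤖; Equivalence; Bijection)
open import Function.Consequences.Propositional using (strictlySurjective⇒surjective)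
open import Function.Definitions using (Injective)
open import Relation.Binary.Definitions using (tri<; tri≈; tri>)
open import Relation.Binary.PropositionalEquality
open import Relation.Nullary using (¬_; Dec; yes; no; does; contradiction)
open import Relation.Nullary.Decidable
  using (map′; ¬?; _×-dec_; _⊎-dec_; _→-dec_; from-yes; dec-true; dec-false)

-- Determinants

Matrix : ℕ → Set
Matrix n = Fin n → Fin n → ℤ

sum-cong : ∀ n {f g : Fin n → ℤ} → (∀ i → f i ≡ g i) → sumFin n f ≡ sumFin n g
sum-cong zero    eq = refl
sum-cong (suc n) eq = cong₂ ℤ._+_ (eq zero) (sum-cong n (λ i → eq (suc i)))

sum-zero : ∀ n {f : Fin n → ℤ} → (∀ i → f i ≡ + 0) → sumFin n f ≡ + 0
sum-zero zero    eq = refl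
sum-zero (suc n) eq = cong₂ ℤ._+_ (eq zero) (sum-zero n (λ i → eq (suc i)))

interchange : ∀ a b c d → (a ℤ.+ b) ℤ.+ (c ℤ.+ d) ≡ (a ℤ.+ c) ℤ.+ (b ℤ.+ d)
interchange = solve-∀

sum-+ : ∀ n (f g : Fin n → ℤ) → sumFin n (λ i → f i ℤ.+ g i) ≡ sumFin n f ℤ.+ sumFin n g
sum-+ zero    f g = refl
sum-+ (suc n) f g = trans
  (cong (ℤ._+_ (f zero ℤ.+ g zero)) (sum-+ n (λ i → f (suc i)) (λ i → g (suc i))))
  (interchange (f zero) (g zero) (sumFin n (λ i → f (suc i))) (sumFin n (λ i → g (suc i))))

sum-*ˡ : ∀ n a (f : Fin n → ℤ) → sumFin n (λ i → a ℤ.* f i) ≡ a ℤ.* sumFin n f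
sum-*ˡ zero    a f = sym (ℤₚ.*-zeroʳ a)
sum-*ˡ (suc n) a f =
  trans (cong (ℤ._+_ (a ℤ.* f zero)) (sum-*ˡ n a (λ i → f (suc i))))
    (sym (ℤₚ.*-distribˡ-+ a (f zero) (sumFin n (λ i → f (suc i)))))

sum-neg : ∀ n (f : Fin n → ℤ) → sumFin n (λ i → - f i) ≡ - sumFin n f
sum-neg zero    f = refl
sum-neg (suc n) f = trans (cong (ℤ._+_ (- f zero)) (sum-neg n (λ i → f (suc i))))
  (sym (ℤₚ.neg-distrib-+ (f zero) (sumFin n (λ i → f (suc i)))))

sum-swap : ∀ n m (f : Fin n → Fin m → ℤ) →
  sumFin n (λ i → sumFin m (f i)) ≡ sumFin m (λ j → sumFin n (λ i → f i j))
sum-swap zero    m f = sym (sum-zero m (λ _ → refl))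
sum-swap (suc n) m f = trans
  (cong (ℤ._+_ (sumFin m (f zero))) (sum-swap n m (λ i → f (suc i))))
  (sym (sum-+ m (f zero) (λ j → sumFin n (λ i → f (suc i) j))))

-- ℤ's operations unfold eagerly, so the summands below can rarely be inferred from the
-- sums and are passed explicitly; `cofactors` names their common shape.
cofactors : ∀ n → (Fin n → ℤ) → (Fin n → ℤ) → Fin n → ℤ
cofactors n a d j = sgn (toℕ j) ℤ.* (a j ℤ.* d j)

sum-cofactors-cong : ∀ n (a : Fin n → ℤ) {d e : Fin n → ℤ} → (∀ j → d j ≡ e j) →
  sumFin n (cofactors n a d) ≡ sumFin n (cofactors n a e)
sum-cofactors-cong n a {d} {e} eq =
  sum-cong n {cofactors n a d} {cofactors n a e} λ j → cong (λ x → sgn (toℕ j) ℤ.* (a j ℤ.* x)) (eq j)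

sum-cofactors-*ˡ : ∀ n (a : Fin n → ℤ) e (d : Fin n → ℤ) →
  sumFin n (cofactors n a (λ j → e ℤ.* d j)) ≡ e ℤ.* sumFin n (cofactors n a d)
sum-cofactors-*ˡ n a e d = trans
  (sum-cong n {cofactors n a (λ j → e ℤ.* d j)} {λ j → e ℤ.* cofactors n a d j}
    λ j → ring e (sgn (toℕ j)) (a j) (d j))
  (sum-*ˡ n e (cofactors n a d))
  where
  ring : ∀ e s a d → s ℤ.* (a ℤ.* (e ℤ.* d)) ≡ e ℤ.* (s ℤ.* (a ℤ.* d))
  ring = solve-∀

sgn-suc : ∀ k → sgn (suc k) ≡ - sgn k
sgn-suc zero          = refl
sgn-suc (suc zero)    = refl
sgn-suc (suc (suc k)) = sgn-suc k

minor : ∀ {n} → Matrix (suc n) → Fin (suc n) → Fin (suc n) → Matrix n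
minor M i j r c = M (punchIn i r) (punchIn j c)

det-cong : ∀ n {M N : Matrix n} → (∀ r c → M r c ≡ N r c) → det n M ≡ det n N
det-cong zero    eq = refl
det-cong (suc n) eq = sum-cong (suc n) λ j → cong (sgn (toℕ j) ℤ.*_)
  (cong₂ ℤ._*_ (eq zero j) (det-cong n (λ r c → eq (suc r) (punchIn j c))))

-- Apart from the corner term, expanding along row 0 and then each minor along its column 0 yields a
-- double sum over the same twofold minors as the opposite order; `exchange` matches the terms with
-- their signs. Since `det` expands along row 0 only, this is the source of transposition
-- invariance.
det-expand-col : ∀ n (M : Matrix (suc n)) →
  det (suc n) M ≡ sumFin (suc n) (cofactors (suc n) (λ i → M i zero) (λ i → det n (minor M i zero)))
det-expand-col zero    M = refl
det-expand-col (suc n) M = cong (ℤ._+_ (+ 1 ℤ.* (M zero zero ℤ.* det (suc n) (minor M zero zero)))) (begin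
  sumFin (suc n) (λ j → s′ j ℤ.* (a j ℤ.* det (suc n) (minor M zero (suc j))))
    ≡⟨ sum-cong (suc n) {λ j → s′ j ℤ.* (a j ℤ.* det (suc n) (minor M zero (suc j)))} {λ j → sumFin (suc n) (F j)}
         (λ j → trans
           (cong (λ d → s′ j ℤ.* (a j ℤ.* d)) (det-expand-col n (minor M zero (suc j))))
           (spread (s′ j) (a j) (λ i → s i ℤ.* (b i ℤ.* d₂ i j)))) ⟩
  sumFin (suc n) (λ j → sumFin (suc n) (F j))
    ≡⟨ sum-swap (suc n) (suc n) F ⟩
  sumFin (suc n) (λ i → sumFin (suc n) (λ j → F j i))
    ≡⟨ sum-cong (suc n) {λ i → sumFin (suc n) (λ j → F j i)}
         {λ i → s′ i ℤ.* (b i ℤ.* det (suc n) (minor M (suc i) zero))}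
         (λ i → trans
           (sum-cong (suc n) {λ j → F j i} {G i} (exchange i))
           (sym (spread (s′ i) (b i) (λ j → s j ℤ.* (a j ℤ.* d₂ i j))))) ⟩
  sumFin (suc n) (λ i → s′ i ℤ.* (b i ℤ.* det (suc n) (minor M (suc i) zero))) ∎)
  where
  open ≡-Reasoning
  s s′ a b : Fin (suc n) → ℤ
  s j = sgn (toℕ j)
  s′ j = sgn (suc (toℕ j))
  a j = M zero (suc j)
  b i = M (suc i) zero
  d₂ F G : Fin (suc n) → Fin (suc n) → ℤ
  d₂ i j = det n (minor (minor M zero (suc j)) i zero)
  F j i = s′ j ℤ.* (a j ℤ.* (s i ℤ.* (b i ℤ.* d₂ i j)))
  G i j = s′ i ℤ.* (b i ℤ.* (s j ℤ.* (a j ℤ.* d₂ i j)))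
  spread : ∀ x y (f : Fin (suc n) → ℤ) →
    x ℤ.* (y ℤ.* sumFin (suc n) f) ≡ sumFin (suc n) (λ i → x ℤ.* (y ℤ.* f i))
  spread x y f = trans (cong (x ℤ.*_) (sym (sum-*ˡ (suc n) y f))) (sym (sum-*ˡ (suc n) x (λ i → y ℤ.* f i)))
  ring : ∀ s t a b d → - s ℤ.* (a ℤ.* (t ℤ.* (b ℤ.* d))) ≡ - t ℤ.* (b ℤ.* (s ℤ.* (a ℤ.* d)))
  ring = solve-∀
  exchange : ∀ i j → F j i ≡ G i j
  exchange i j = trans
    (cong (λ x → x ℤ.* (a j ℤ.* (s i ℤ.* (b i ℤ.* d₂ i j)))) (sgn-suc (toℕ j)))
    (trans (ring (s j) (s i) (a j) (b i) (d₂ i j))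
      (cong (λ x → x ℤ.* (b i ℤ.* (s j ℤ.* (a j ℤ.* d₂ i j)))) (sym (sgn-suc (toℕ i)))))

det-transpose : ∀ n (M : Matrix n) → det n (λ r c → M c r) ≡ det n M
det-transpose zero    M = refl
det-transpose (suc n) M = trans
  (sum-cofactors-cong (suc n) (λ j → M j zero) λ j → det-transpose n (minor M j zero))
  (sym (det-expand-col n M))

swap₀₁ : ∀ {n} → Fin (suc (suc n)) → Fin (suc (suc n))
swap₀₁ zero          = suc zero
swap₀₁ (suc zero)    = zero
swap₀₁ (suc (suc i)) = suc (suc i)

-- The terms of the two exchanged columns trade places and change sign. In every other term the
-- minor still has both columns in front, so induction applies.
det-swap-cols : ∀ n (M : Matrix (suc (suc n))) →
  det (suc (suc n)) (λ r c → M r (swap₀₁ c)) ≡ - det (suc (suc n)) M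
det-swap-cols n M = begin
  + 1 ℤ.* (b ℤ.* det (suc n) (λ r c → M (suc r) (swap₀₁ (suc c)))) ℤ.+
    (- + 1 ℤ.* (a ℤ.* det (suc n) (λ r c → M (suc r) (swap₀₁ (punchIn (suc zero) c)))) ℤ.+ S′)
    ≡⟨ cong₂ (λ d e → + 1 ℤ.* (b ℤ.* d) ℤ.+ (- + 1 ℤ.* (a ℤ.* e) ℤ.+ S′))
         (det-cong (suc n) λ r c → cong (M (suc r)) (swap-suc c))
         (det-cong (suc n) λ r c → cong (M (suc r)) (swap-punch c)) ⟩
  + 1 ℤ.* (b ℤ.* q) ℤ.+ (- + 1 ℤ.* (a ℤ.* p) ℤ.+ S′)
    ≡⟨ cong (λ s → + 1 ℤ.* (b ℤ.* q) ℤ.+ (- + 1 ℤ.* (a ℤ.* p) ℤ.+ s)) (rest n M) ⟩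
  + 1 ℤ.* (b ℤ.* q) ℤ.+ (- + 1 ℤ.* (a ℤ.* p) ℤ.+ - S)
    ≡⟨ ring a b p q S ⟩
  - (+ 1 ℤ.* (a ℤ.* p) ℤ.+ (- + 1 ℤ.* (b ℤ.* q) ℤ.+ S)) ∎
  where
  open ≡-Reasoning
  a = M zero zero
  b = M zero (suc zero)
  p = det (suc n) (minor M zero zero)
  q = det (suc n) (minor M zero (suc zero))
  tail′ tail : ∀ n (M : Matrix (suc (suc n))) → Fin n → ℤ
  tail′ n M j = sgn (toℕ j) ℤ.* (M zero (suc (suc j)) ℤ.*
    det (suc n) (λ r c → M (suc r) (swap₀₁ (punchIn (suc (suc j)) c))))
  tail n M j = sgn (toℕ j) ℤ.* (M zero (suc (suc j)) ℤ.* det (suc n) (minor M zero (suc (suc j))))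
  S′ = sumFin n (tail′ n M)
  S  = sumFin n (tail n M)
  swap-suc : ∀ c → swap₀₁ {n} (suc c) ≡ punchIn (suc zero) c
  swap-suc zero    = refl
  swap-suc (suc c) = refl
  swap-punch : ∀ c → swap₀₁ {n} (punchIn (suc zero) c) ≡ suc c
  swap-punch zero    = refl
  swap-punch (suc c) = refl
  commute : ∀ {n} (j : Fin (suc n)) c → swap₀₁ (punchIn (suc (suc j)) c) ≡ punchIn (suc (suc j)) (swap₀₁ c)
  commute j zero          = refl
  commute j (suc zero)    = refl
  commute j (suc (suc c)) = refl
  neg : ∀ s m d → s ℤ.* (m ℤ.* - d) ≡ - (s ℤ.* (m ℤ.* d))
  neg = solve-∀
  rest : ∀ n M → sumFin n (tail′ n M) ≡ - sumFin n (tail n M)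
  rest zero    M = refl
  rest (suc n) M = trans
    (sum-cong (suc n) {tail′ (suc n) M} {λ j → - tail (suc n) M j} λ j → trans
      (cong (λ d → sgn (toℕ j) ℤ.* (M zero (suc (suc j)) ℤ.* d)) (trans
        (det-cong (suc (suc n)) λ r c → cong (M (suc r)) (commute j c))
        (det-swap-cols n (minor M zero (suc (suc j))))))
      (neg (sgn (toℕ j)) (M zero (suc (suc j))) (det (suc (suc n)) (minor M zero (suc (suc j))))))
    (sum-neg (suc n) (tail (suc n) M))
  ring : ∀ a b p q s → + 1 ℤ.* (b ℤ.* q) ℤ.+ (- + 1 ℤ.* (a ℤ.* p) ℤ.+ - s) ≡
    - (+ 1 ℤ.* (a ℤ.* p) ℤ.+ (- + 1 ℤ.* (b ℤ.* q) ℤ.+ s))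
  ring = solve-∀

det-swap-rows : ∀ n (M : Matrix (suc (suc n))) →
  det (suc (suc n)) (λ r c → M (swap₀₁ r) c) ≡ - det (suc (suc n)) M
det-swap-rows n M = begin
  det (suc (suc n)) (λ r c → M (swap₀₁ r) c) ≡⟨ det-transpose (suc (suc n)) (λ c r → M (swap₀₁ r) c) ⟩
  det (suc (suc n)) (λ c r → M (swap₀₁ r) c) ≡⟨ det-swap-cols n (λ c r → M r c) ⟩
  - det (suc (suc n)) (λ c r → M r c)         ≡⟨ cong -_ (det-transpose (suc (suc n)) M) ⟩
  - det (suc (suc n)) M                       ∎
  where open ≡-Reasoning

self-neg⇒0 : ∀ d → d ≡ - d → d ≡ + 0
self-neg⇒0 (+ zero) _ = refl
self-neg⇒0 (+ suc n) ()
self-neg⇒0 (ℤ.-[1+ n ]) ()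

det-equal-rows : ∀ n (M : Matrix (suc (suc n))) → (∀ c → M zero c ≡ M (suc zero) c) →
  det (suc (suc n)) M ≡ + 0
det-equal-rows n M eq = self-neg⇒0 _ (trans (det-cong (suc (suc n)) swapped) (det-swap-rows n M))
  where
  swapped : ∀ r c → M r c ≡ M (swap₀₁ r) c
  swapped zero          c = eq c
  swapped (suc zero)    c = sym (eq c)
  swapped (suc (suc r)) c = refl

-- Subtracting row 1 from row 0, and then column 1 from column 0, leaves a single
-- ±1 in row 0 and in column 0.
det-twins : ∀ n (M : Matrix (suc (suc n))) →
  M zero zero ≡ + 0 → M zero (suc zero) ≡ + 1 → M (suc zero) zero ≡ - + 1 → M (suc zero) (suc zero) ≡ + 0 →
  (∀ c → M zero (suc (suc c)) ≡ M (suc zero) (suc (suc c))) →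
  (∀ r → M (suc (suc r)) zero ≡ M (suc (suc r)) (suc zero)) →
  det (suc (suc n)) M ≡ det n (λ r c → M (suc (suc r)) (suc (suc c)))
det-twins n M m₀₀ m₀₁ m₁₀ m₁₁ rows cols = begin
  det (suc (suc n)) M
    ≡⟨ difference (suc (suc n)) (M zero) (M (suc zero)) D ⟩
  sumFin (suc (suc n)) Δrows ℤ.+ det (suc (suc n)) N
    ≡⟨ cong₂ ℤ._+_ (sum-two Δrows (λ j → vanish (sgn (toℕ j)) _ _ (D (suc (suc j))) (rows j)))
         (det-equal-rows n N (λ _ → refl)) ⟩
  (Δrows zero ℤ.+ Δrows (suc zero)) ℤ.+ + 0
    ≡⟨ cong (ℤ._+ + 0) (cong₂ (λ x y → (+ 1 ℤ.* (x ℤ.* p)) ℤ.+ (- + 1 ℤ.* (y ℤ.* q)))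
         (cong₂ ℤ._-_ m₀₀ m₁₀) (cong₂ ℤ._-_ m₀₁ m₁₁)) ⟩
  ((+ 1 ℤ.* (+ 1 ℤ.* p)) ℤ.+ (- + 1 ℤ.* (+ 1 ℤ.* q))) ℤ.+ + 0
    ≡⟨ ring₁ p q ⟩
  p ℤ.- q
    -- The two minors differ only in their first column, so they share the cofactors `e`, and their
    -- difference is a single expansion along column 1 minus column 0 of `M`.
    ≡⟨ cong₂ ℤ._-_ (det-expand-col n (minor M zero zero)) (det-expand-col n (minor M zero (suc zero))) ⟩
  sumFin (suc n) (cofactors (suc n) (λ i → M (suc i) (suc zero)) e) ℤ.- R
    ≡⟨ cong (ℤ._- R) (difference (suc n) (λ i → M (suc i) (suc zero)) (λ i → M (suc i) zero) e) ⟩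
  (sumFin (suc n) Δcols ℤ.+ R) ℤ.- R
    ≡⟨ ring₂ (sumFin (suc n) Δcols) R ⟩
  sumFin (suc n) Δcols
    ≡⟨ cong₂ (λ x y → + 1 ℤ.* (x ℤ.* e zero) ℤ.+ y) (cong₂ ℤ._-_ m₁₁ m₁₀)
         (sum-zero n {λ i → Δcols (suc i)}
           λ i → vanish (sgn (suc (toℕ i))) _ _ (e (suc i)) (sym (cols i))) ⟩
  + 1 ℤ.* (+ 1 ℤ.* e zero) ℤ.+ + 0
    ≡⟨ ring₃ (e zero) ⟩
  det n (λ r c → M (suc (suc r)) (suc (suc c))) ∎
  where
  open ≡-Reasoning
  N : Matrix (suc (suc n))
  N zero    c = M (suc zero) c
  N (suc r) c = M (suc r) c
  D Δrows : Fin (suc (suc n)) → ℤ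
  D j = det (suc n) (minor M zero j)
  Δrows = cofactors (suc (suc n)) (λ j → M zero j ℤ.- M (suc zero) j) D
  p = D zero
  q = D (suc zero)
  e Δcols : Fin (suc n) → ℤ
  e i = det n (λ r c → M (suc (punchIn i r)) (suc (suc c)))
  Δcols = cofactors (suc n) (λ i → M (suc i) (suc zero) ℤ.- M (suc i) zero) e
  R = sumFin (suc n) (cofactors (suc n) (λ i → M (suc i) zero) e)
  split : ∀ s a b d → s ℤ.* (a ℤ.* d) ≡ s ℤ.* ((a ℤ.- b) ℤ.* d) ℤ.+ s ℤ.* (b ℤ.* d)
  split = solve-∀
  difference : ∀ m f g d → sumFin m (cofactors m f d) ≡
    sumFin m (cofactors m (λ j → f j ℤ.- g j) d) ℤ.+ sumFin m (cofactors m g d)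
  difference m f g d = trans
    (sum-cong m {cofactors m f d} {λ j → cofactors m (λ j → f j ℤ.- g j) d j ℤ.+ cofactors m g d j}
      λ j → split (sgn (toℕ j)) (f j) (g j) (d j))
    (sum-+ m (cofactors m (λ j → f j ℤ.- g j) d) (cofactors m g d))
  cancel : ∀ s a d → s ℤ.* ((a ℤ.- a) ℤ.* d) ≡ + 0
  cancel = solve-∀
  vanish : ∀ s a b d → a ≡ b → s ℤ.* ((a ℤ.- b) ℤ.* d) ≡ + 0
  vanish s a b d refl = cancel s a d
  sum-two : ∀ {m} (f : Fin (suc (suc m)) → ℤ) → (∀ j → f (suc (suc j)) ≡ + 0) →
    sumFin (suc (suc m)) f ≡ f zero ℤ.+ f (suc zero)
  sum-two {m} f eq = trans
    (cong (λ s → f zero ℤ.+ (f (suc zero) ℤ.+ s)) (sum-zero m {λ j → f (suc (suc j))} eq))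
    (cong (ℤ._+_ (f zero)) (ℤₚ.+-identityʳ (f (suc zero))))
  ring₁ : ∀ p q → ((+ 1 ℤ.* (+ 1 ℤ.* p)) ℤ.+ (- + 1 ℤ.* (+ 1 ℤ.* q))) ℤ.+ + 0 ≡ p ℤ.- q
  ring₁ = solve-∀
  ring₂ : ∀ a b → (a ℤ.+ b) ℤ.- b ≡ a
  ring₂ = solve-∀
  ring₃ : ∀ a → + 1 ℤ.* (+ 1 ℤ.* a) ℤ.+ + 0 ≡ a
  ring₃ = solve-∀

prod : ∀ n → (Fin n → ℤ) → ℤ
prod zero    d = + 1
prod (suc n) d = d zero ℤ.* prod n (λ i → d (suc i))

det-scale-rows : ∀ n (d : Fin n → ℤ) (M : Matrix n) → det n (λ r c → d r ℤ.* M r c) ≡ prod n d ℤ.* det n M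
det-scale-rows zero    d M = refl
det-scale-rows (suc n) d M = trans
  (sum-cong (suc n)
    {cofactors (suc n) (λ j → d zero ℤ.* M zero j) (λ j → det n (λ r c → d (suc r) ℤ.* minor M zero j r c))}
    {λ j → prod (suc n) d ℤ.* cofactors (suc n) (M zero) (λ j → det n (minor M zero j)) j}
    λ j → trans
      (cong (λ x → sgn (toℕ j) ℤ.* (d zero ℤ.* M zero j ℤ.* x)) (det-scale-rows n (λ i → d (suc i)) (minor M zero j)))
      (ring (sgn (toℕ j)) (d zero) (M zero j) (prod n (λ i → d (suc i))) (det n (minor M zero j))))
  (sum-*ˡ (suc n) (prod (suc n) d) (cofactors (suc n) (M zero) (λ j → det n (minor M zero j))))
  where
  ring : ∀ s a m p x → s ℤ.* (a ℤ.* m ℤ.* (p ℤ.* x)) ≡ (a ℤ.* p) ℤ.* (s ℤ.* (m ℤ.* x))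
  ring = solve-∀

det-scale-cols : ∀ n (d : Fin n → ℤ) (M : Matrix n) → det n (λ r c → d c ℤ.* M r c) ≡ prod n d ℤ.* det n M
det-scale-cols n d M = begin
  det n (λ r c → d c ℤ.* M r c) ≡⟨ det-transpose n (λ c r → d c ℤ.* M r c) ⟩
  det n (λ c r → d c ℤ.* M r c) ≡⟨ det-scale-rows n d (λ c r → M r c) ⟩
  prod n d ℤ.* det n (λ c r → M r c) ≡⟨ cong (prod n d ℤ.*_) (det-transpose n M) ⟩
  prod n d ℤ.* det n M ∎
  where open ≡-Reasoning

prod-square : ∀ n (d : Fin n → ℤ) → (∀ i → d i ℤ.* d i ≡ + 1) → prod n d ℤ.* prod n d ≡ + 1
prod-square zero    d sq = refl
prod-square (suc n) d sq = trans (ring (d zero) (prod n (λ i → d (suc i))))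
  (cong₂ ℤ._*_ (sq zero) (prod-square n (λ i → d (suc i)) (λ i → sq (suc i))))
  where
  ring : ∀ a p → (a ℤ.* p) ℤ.* (a ℤ.* p) ≡ (a ℤ.* a) ℤ.* (p ℤ.* p)
  ring = solve-∀

-- Determinants under reordering of rows and columns

infix 4 _↭_
data _↭_ {A : Set} : ∀ {n} → Vec A n → Vec A n → Set where
  ↭-refl  : ∀ {n} {xs : Vec A n} → xs ↭ xs
  ↭-prep  : ∀ {n} x {xs ys : Vec A n} → xs ↭ ys → x ∷ xs ↭ x ∷ ys
  ↭-swap  : ∀ {n} x y {xs : Vec A n} → x ∷ y ∷ xs ↭ y ∷ x ∷ xs
  ↭-trans : ∀ {n} {xs ys zs : Vec A n} → xs ↭ ys → ys ↭ zs → xs ↭ zs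

-- The sign `ε` is fixed before `S` and `g`, so that the same one serves for the rows and later for
-- the columns. The column labels `g` are independent of the permuted list because row expansion
-- replaces them by `g (punchIn j c)` in the minors.
↭-sign : ∀ {A : Set} {n} {xs ys : Vec A n} → xs ↭ ys → Σ ℤ λ ε → ε ℤ.* ε ≡ + 1 ×
  (∀ {C : Set} (S : A → C → ℤ) (g : Fin n → C) →
    det n (λ r c → S (lookup xs r) (g c)) ≡ ε ℤ.* det n (λ r c → S (lookup ys r) (g c)))
↭-sign {n = n} (↭-refl {xs = xs}) = + 1 , refl , λ S g →
  sym (ℤₚ.*-identityˡ (det n (λ r c → S (lookup xs r) (g c))))
↭-sign (↭-prep {n} x {xs} {ys} σ) with ↭-sign σ
... | ε , ε² , eq = ε , ε² , λ S g →
  let d = λ j → det n (λ r c → S (lookup ys r) (g (punchIn j c))) in trans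
    (sum-cofactors-cong (suc n) (λ j → S x (g j)) {e = λ j → ε ℤ.* d j} λ j → eq S (λ c → g (punchIn j c)))
    (sum-cofactors-*ˡ (suc n) (λ j → S x (g j)) ε d)
↭-sign (↭-swap {n} x y {xs}) = - + 1 , refl , λ S g → trans
  (trans (det-cong (suc (suc n)) λ r c → cong (λ v → S v (g c)) (swapped r))
    (det-swap-rows n (λ r c → S (lookup (y ∷ x ∷ xs) r) (g c))))
  (sym (ℤₚ.-1*i≡-i (det (suc (suc n)) (λ r c → S (lookup (y ∷ x ∷ xs) r) (g c)))))
  where
  swapped : ∀ r → lookup (x ∷ y ∷ xs) r ≡ lookup (y ∷ x ∷ xs) (swap₀₁ r)
  swapped zero          = refl
  swapped (suc zero)    = refl
  swapped (suc (suc r)) = refl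
↭-sign (↭-trans {zs = zs} σ τ) with ↭-sign σ | ↭-sign τ
... | ε , ε² , eq | δ , δ² , eq′ = ε ℤ.* δ , trans (ring ε δ) (cong₂ ℤ._*_ ε² δ²) ,
  λ S g → trans (eq S g) (trans (cong (ε ℤ.*_) (eq′ S g))
    (sym (ℤₚ.*-assoc ε δ (det _ (λ r c → S (lookup zs r) (g c))))))
  where
  ring : ∀ a p → (a ℤ.* p) ℤ.* (a ℤ.* p) ≡ (a ℤ.* a) ℤ.* (p ℤ.* p)
  ring = solve-∀

detOn : ∀ {A : Set} {n} → (A → A → ℤ) → Vec A n → ℤ
detOn {n = n} S xs = det n (λ r c → S (lookup xs r) (lookup xs c))

-- The sign `ε` arises once from the rows and, after transposing, once more from the columns; its
-- square is 1.
detOn-↭ : ∀ {A : Set} {n} (S : A → A → ℤ) {xs ys : Vec A n} → xs ↭ ys → detOn S xs ≡ detOn S ys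
detOn-↭ {n = n} S {xs} {ys} σ with ↭-sign σ
... | ε , ε² , eq = begin
  detOn S xs
    ≡⟨ eq S (lookup xs) ⟩
  ε ℤ.* det n (λ r c → S (lookup ys r) (lookup xs c))
    ≡⟨ cong (ε ℤ.*_) (sym (det-transpose n (λ r c → S (lookup ys r) (lookup xs c)))) ⟩
  ε ℤ.* det n (λ r c → S (lookup ys c) (lookup xs r))
    ≡⟨ cong (ε ℤ.*_) (eq (λ y x → S x y) (lookup ys)) ⟩
  ε ℤ.* (ε ℤ.* det n (λ r c → S (lookup ys c) (lookup ys r)))
    ≡⟨ sym (ℤₚ.*-assoc ε ε (det n (λ r c → S (lookup ys c) (lookup ys r)))) ⟩
  (ε ℤ.* ε) ℤ.* det n (λ r c → S (lookup ys c) (lookup ys r))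
    ≡⟨ cong₂ ℤ._*_ ε² (det-transpose n (λ r c → S (lookup ys r) (lookup ys c))) ⟩
  + 1 ℤ.* detOn S ys
    ≡⟨ ℤₚ.*-identityˡ (detOn S ys) ⟩
  detOn S ys ∎
  where open ≡-Reasoning

-- Switching and embedded patterns

open IsTournament

signOf : Bool → ℤ
signOf b = if b then - + 1 else + 1

signOf-square : ∀ b → signOf b ℤ.* signOf b ≡ + 1
signOf-square true  = refl
signOf-square false = refl

skew-switch : ∀ {n} {T : Rel n} → IsTournament T → ∀ W i j →
  skew (switch T W) i j ≡ signOf (W i) ℤ.* (signOf (W j) ℤ.* skew T i j)
skew-switch {T = T} t W i j with i Fin.≟ j
... | yes refl rewrite irrefl t i with W i
...   | true  = refl
...   | false = refl
skew-switch {T = T} t W i j | no i≢j rewrite oneArc t i j i≢j with T j i | W i | W j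
... | true  | true  | true  = refl
... | true  | true  | false = refl
... | true  | false | true  = refl
... | true  | false | false = refl
... | false | true  | true  = refl
... | false | true  | false = refl
... | false | false | true  = refl
... | false | false | false = refl

detT-switch : ∀ {n} {T : Rel n} → IsTournament T → ∀ W → detT (switch T W) ≡ detT T
detT-switch {n} {T} t W = begin
  det n (skew (switch T W))
    ≡⟨ det-cong n (skew-switch t W) ⟩
  det n (λ r c → d r ℤ.* (d c ℤ.* skew T r c))
    ≡⟨ det-scale-rows n d (λ r c → d c ℤ.* skew T r c) ⟩
  prod n d ℤ.* det n (λ r c → d c ℤ.* skew T r c)
    ≡⟨ cong (prod n d ℤ.*_) (det-scale-cols n d (skew T)) ⟩
  prod n d ℤ.* (prod n d ℤ.* detT T)
    ≡⟨ sym (ℤₚ.*-assoc (prod n d) (prod n d) (detT T)) ⟩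
  (prod n d ℤ.* prod n d) ℤ.* detT T
    ≡⟨ cong (ℤ._* detT T) (prod-square n d (signOf-square ∘ W)) ⟩
  + 1 ℤ.* detT T
    ≡⟨ ℤₚ.*-identityˡ (detT T) ⟩
  detT T ∎
  where
  open ≡-Reasoning
  d = signOf ∘ W

sub-isTournament : ∀ {n m} {T : Rel n} {f : Fin m → Fin n} → Injective _≡_ _≡_ f →
  IsTournament T → IsTournament (sub T f)
sub-isTournament inj t .irrefl i       = irrefl t _
sub-isTournament inj t .oneArc i j i≢j = oneArc t _ _ (i≢j ∘ inj)

switch-isTournament : ∀ {n} {T : Rel n} → IsTournament T → ∀ W → IsTournament (switch T W)
switch-isTournament t W .irrefl i rewrite irrefl t i = Boolₚ.xor-same (W i)
switch-isTournament {T = T} t W .oneArc i j i≢j rewrite oneArc t i j i≢j with T j i | W i | W j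
... | true  | true  | true  = refl
... | true  | true  | false = refl
... | true  | false | true  = refl
... | true  | false | false = refl
... | false | true  | true  = refl
... | false | true  | false = refl
... | false | false | true  = refl
... | false | false | false = refl

-- Restriction commutes with switching by definition: `sub (switch T W) f` is
-- `switch (sub T f) (W ∘ f)`, so `detT-switch` applies to each subtournament.
InD-switch : ∀ {k n} {T : Rel n} → IsTournament T → ∀ W → InD k T → InD k (switch T W)
InD-switch {k} t W d m f inj =
  subst (ℤ._≤ + (k ℕ.* k)) (sym (detT-switch (sub-isTournament inj t) (W ∘ f))) (d m f inj)

InD-unswitch : ∀ {k n} {T : Rel n} → IsTournament T → ∀ W → InD k (switch T W) → InD k T
InD-unswitch {k} t W d m f inj =
  subst (ℤ._≤ + (k ℕ.* k)) (detT-switch (sub-isTournament inj t) (W ∘ f)) (d m f inj)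

InD-mono : ∀ {j k n} {T : Rel n} → j ℕ.≤ k → InD j T → InD k T
InD-mono j≤k d m f inj = ℤₚ.≤-trans (d m f inj) (ℤ.+≤+ (ℕₚ.*-mono-≤ j≤k j≤k))

isTournament? : ∀ {n} (T : Rel n) → Dec (IsTournament T)
isTournament? T = map′ (λ (p , q) → record { irrefl = p ; oneArc = q }) (λ t → irrefl t , oneArc t)
  (all? (λ i → T i i Bool.≟ false) ×-dec
   all? (λ i → all? λ j → ¬? (i Fin.≟ j) →-dec (T i j Bool.≟ not (T j i))))

record Copy {n m : ℕ} (T : Rel n) (P : Rel m) (e : Fin m → Fin n) : Set where
  field
    arc : ∀ i j → T (e i) (e j) ≡ P i j

open Copy

-- Two distinct vertices of `P` carry an arc in one direction; if they had the same image, that arc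
-- would become a loop of `T`.
copy-injective : ∀ {n m} {T : Rel n} {P : Rel m} {e} → IsTournament T → IsTournament P →
  Copy T P e → Injective _≡_ _≡_ e
copy-injective {T = T} {P} {e} t p c {i} {j} ei≡ej with i Fin.≟ j
... | yes i≡j = i≡j
... | no  i≢j = contradiction
  (trans (sym (false-at i j ei≡ej)) (trans (oneArc p i j i≢j) (cong not (false-at j i (sym ei≡ej))))) λ ()
  where
  false-at : ∀ i j → e i ≡ e j → P i j ≡ false
  false-at i j eq = trans (sym (arc c i j)) (trans (cong (T (e i)) (sym eq)) (irrefl t (e i)))

skew-cong : ∀ {n} {S T : Rel n} → (∀ i j → S i j ≡ T i j) → ∀ i j → skew S i j ≡ skew T i j
skew-cong eq i j rewrite eq i j | eq j i = refl

copy-det≤ : ∀ {k n m} {T : Rel n} {P : Rel (suc m)} {e} → IsTournament T → IsTournament P →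
  Copy T P e → InD k T → detT P ℤ.≤ + (k ℕ.* k)
copy-det≤ {k} {m = m} {e = e} t p c d =
  subst (ℤ._≤ + (k ℕ.* k)) (det-cong (suc m) (skew-cong (arc c))) (d m e (copy-injective t p c))

-- A record rather than an abbreviation: otherwise unifying two bounds unfolds the determinants.
record Exceeds (k : ℕ) {m : ℕ} (P : Rel m) : Set where
  constructor exceeds
  field
    large : + (k ℕ.* k) ℤ.< detT P

exceeds? : ∀ k {m} (P : Rel m) → Dec (Exceeds k P)
exceeds? k P = map′ exceeds Exceeds.large (+ (k ℕ.* k) ℤₚ.<? detT P)

copy-exceeds : ∀ {k n m} {T : Rel n} {P : Rel (suc m)} {e} → Exceeds k P → IsTournament T → IsTournament P →
  Copy T P e → ¬ InD k T
copy-exceeds {k} (exceeds large) t p c d = ℤₚ.<⇒≱ large (copy-det≤ {k} t p c d)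

-- The patterns with added vertices are iterated cones, so that `copy-cone` embeds them one vertex
-- at a time.
cone : ∀ {m} → Rel m → (Fin m → Bool) → Rel (suc m)
cone P b zero    zero    = false
cone P b zero    (suc j) = b j
cone P b (suc i) zero    = not (b i)
cone P b (suc i) (suc j) = P i j

cone-isTournament : ∀ {m} {P : Rel m} → IsTournament P → ∀ b → IsTournament (cone P b)
cone-isTournament p b .irrefl zero    = refl
cone-isTournament p b .irrefl (suc i) = irrefl p i
cone-isTournament p b .oneArc zero    zero    ne = contradiction refl ne
cone-isTournament p b .oneArc zero    (suc j) ne = sym (Boolₚ.not-involutive (b j))
cone-isTournament p b .oneArc (suc i) zero    ne = refl
cone-isTournament p b .oneArc (suc i) (suc j) ne = oneArc p i j (ne ∘ cong suc)

copy-cone : ∀ {n m} {T : Rel n} {P : Rel m} {e b w} → IsTournament T → Copy T P e →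
  (∀ i → w ≢ e i) → (∀ i → T w (e i) ≡ b i) → Copy T (cone P b) (w VF.∷ e)
copy-cone t c fresh eq .arc zero    zero    = irrefl t _
copy-cone t c fresh eq .arc zero    (suc j) = eq j
copy-cone t c fresh eq .arc (suc i) zero    = trans (oneArc t _ _ (fresh i ∘ sym)) (cong not (eq i))
copy-cone t c fresh eq .arc (suc i) (suc j) = arc c i j

copy-sub : ∀ {n m l} {T : Rel n} {P : Rel m} {e} → Copy T P e → (f : Fin l → Fin m) → Copy T (sub P f) (e ∘ f)
copy-sub c f .arc i j = arc c (f i) (f j)

copy-cong : ∀ {n m} {T : Rel n} {P Q : Rel m} {e} → (∀ i j → P i j ≡ Q i j) → Copy T P e → Copy T Q e
copy-cong eq c .arc i j = trans (arc c i j) (eq i j)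

-- The switching of the host that realises a given switching of an embedded pattern.
extend : ∀ {n m} → (Fin m → Fin n) → (Fin m → Bool) → Fin n → Bool
extend e W v with any? (λ i → e i Fin.≟ v)
... | yes (i , _) = W i
... | no  _       = false

extend-at : ∀ {n m} {e : Fin m → Fin n} → Injective _≡_ _≡_ e → ∀ W i → extend e W (e i) ≡ W i
extend-at {e = e} inj W i with any? (λ j → e j Fin.≟ e i)
... | yes (j , eq) = cong W (inj eq)
... | no  none     = contradiction (i , refl) none

switch-switch : ∀ {n} (T : Rel n) V W i j →
  switch T (λ v → V v xor W v) i j ≡ switch (switch T V) W i j
switch-switch T V W i j = begin
  T i j xor ((V i xor W i) xor (V j xor W j)) ≡⟨ cong (T i j xor_) (swapMiddle (V i) (W i) (V j) (W j)) ⟩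
  T i j xor ((V i xor V j) xor (W i xor W j)) ≡⟨ sym (Boolₚ.xor-assoc (T i j) _ _) ⟩
  (T i j xor (V i xor V j)) xor (W i xor W j) ∎
  where
  open ≡-Reasoning
  swapMiddle : ∀ a b c d → (a xor b) xor (c xor d) ≡ (a xor c) xor (b xor d)
  swapMiddle true  true  true  d = refl
  swapMiddle true  true  false d = sym (Boolₚ.not-involutive d)
  swapMiddle true  false true  d = Boolₚ.not-involutive d
  swapMiddle true  false false d = refl
  swapMiddle false true  true  d = refl
  swapMiddle false true  false d = refl
  swapMiddle false false true  d = refl
  swapMiddle false false false d = refl

-- Determinants of blowups

All-resp-↭ : ∀ {A : Set} {P : A → Set} {n} {xs ys : Vec A n} → xs ↭ ys → All P xs → All P ys
All-resp-↭ ↭-refl        ps            = ps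
All-resp-↭ (↭-prep x σ)  (p ∷ ps)      = p ∷ All-resp-↭ σ ps
All-resp-↭ (↭-swap x y)  (p ∷ q ∷ ps)  = q ∷ p ∷ ps
All-resp-↭ (↭-trans σ τ) ps            = All-resp-↭ τ (All-resp-↭ σ ps)

Any-resp-↭ : ∀ {A : Set} {P : A → Set} {n} {xs ys : Vec A n} → xs ↭ ys → Any P xs → Any P ys
Any-resp-↭ ↭-refl        p                 = p
Any-resp-↭ (↭-prep x σ)  (here p)          = here p
Any-resp-↭ (↭-prep x σ)  (there p)         = there (Any-resp-↭ σ p)
Any-resp-↭ (↭-swap x y)  (here p)          = there (here p)
Any-resp-↭ (↭-swap x y)  (there (here p))  = here p
Any-resp-↭ (↭-swap x y)  (there (there p)) = there (there p)
Any-resp-↭ (↭-trans σ τ) p                 = Any-resp-↭ τ (Any-resp-↭ σ p)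

AllPairs-lookup : ∀ {A : Set} {R : A → A → Set} {n} {xs : Vec A n} → AllPairs R xs →
  ∀ {i j} → i Fin.< j → R (lookup xs i) (lookup xs j)
AllPairs-lookup (p ∷ ps) {zero}  {suc j} _         = Allₚ.lookup⁺ p j
AllPairs-lookup (p ∷ ps) {suc i} {suc j} (ℕ.s≤s lt) = AllPairs-lookup ps lt

-- The relation `_◃_` is constrained only within a label. The order serves twice: for points of a
-- blowup, compared by height inside a block, and for vertices of a tournament, compared by its arcs
-- inside a class.
module Lexicographic {A : Set} {k : ℕ} (ℓ : A → Fin k) (_◃_ : A → A → Set)
  (◃-trans : ∀ {x y z} → ℓ x ≡ ℓ y → ℓ y ≡ ℓ z → x ◃ y → y ◃ z → x ◃ z)
  (◃-total : ∀ {x y} → ℓ x ≡ ℓ y → x ≢ y → x ◃ y ⊎ y ◃ x) where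

  infix 4 _≺_
  _≺_ : A → A → Set
  x ≺ y = ℓ x Fin.< ℓ y ⊎ (ℓ x ≡ ℓ y × x ◃ y)

  ≺-trans : ∀ {x y z} → x ≺ y → y ≺ z → x ≺ z
  ≺-trans         (inj₁ p)       (inj₁ q)       = inj₁ (ℕₚ.<-trans p q)
  ≺-trans {x}     (inj₁ p)       (inj₂ (e , _)) = inj₁ (subst (ℓ x Fin.<_) e p)
  ≺-trans {z = z} (inj₂ (e , _)) (inj₁ q)       = inj₁ (subst (Fin._< ℓ z) (sym e) q)
  ≺-trans         (inj₂ (e , p)) (inj₂ (f , q)) = inj₂ (trans e f , ◃-trans e f p q)

  ≺-total : ∀ {x y} → x ≢ y → x ≺ y ⊎ y ≺ x
  ≺-total {x} {y} x≢y with ℕₚ.<-cmp (toℕ (ℓ x)) (toℕ (ℓ y))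
  ... | tri< lt _ _ = inj₁ (inj₁ lt)
  ... | tri> _ _ gt = inj₂ (inj₁ gt)
  ... | tri≈ _ eq _ with ◃-total (Finₚ.toℕ-injective eq) x≢y
  ...   | inj₁ lt = inj₁ (inj₂ (Finₚ.toℕ-injective eq , lt))
  ...   | inj₂ gt = inj₂ (inj₂ (sym (Finₚ.toℕ-injective eq) , gt))

  insert : ∀ {n} x {ys : Vec A n} → AllPairs _≺_ ys → All (x ≢_) ys →
    Σ (Vec A (suc n)) λ zs → x ∷ ys ↭ zs × AllPairs _≺_ zs
  insert x [] [] = x ∷ [] , ↭-refl , [] ∷ []
  insert x {y ∷ ys} (y≺ ∷ sorted) (x≢y ∷ x≢) with ≺-total x≢y
  ... | inj₁ x≺y = x ∷ y ∷ ys , ↭-refl , (x≺y ∷ All.map (≺-trans x≺y) y≺) ∷ y≺ ∷ sorted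
  ... | inj₂ y≺x with insert x sorted x≢
  ...   | zs , σ , sorted′ =
    y ∷ zs , ↭-trans (↭-swap x y) (↭-prep y σ) , All-resp-↭ σ (y≺x ∷ y≺) ∷ sorted′

  sort : ∀ {n} {xs : Vec A n} → AllPairs _≢_ xs → Σ (Vec A n) λ ys → xs ↭ ys × AllPairs _≺_ ys
  sort [] = [] , ↭-refl , []
  sort (x≢ ∷ distinct) with sort distinct
  ... | ys , σ , sorted with insert _ sorted (All-resp-↭ σ x≢)
  ...   | zs , τ , sorted′ = zs , ↭-trans (↭-prep _ σ) τ , sorted′

  -- This is the form that `det-twins` requires: the pair stands in front and no other entry lies
  -- between `u` and `v`. The remaining entries stay sorted, so the reduction can be repeated.
  data Neighbours : ∀ {n} → Vec A n → Set where
    neighbours : ∀ {n} {xs : Vec A (suc (suc n))} u v (zs : Vec A n) → ℓ u ≡ ℓ v → u ◃ v →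
      xs ↭ u ∷ v ∷ zs → AllPairs _≺_ zs → All (λ z → z ≺ u ⊎ v ≺ z) zs → Neighbours xs

  -- If no two consecutive labels agree, sortedness makes the labels increase strictly, and the
  -- entries then come from distinct blocks.
  findNeighbours : ∀ {n} {xs : Vec A n} → AllPairs _≺_ xs → AllPairs (Fin._<_ on ℓ) xs ⊎ Neighbours xs
  findNeighbours []             = inj₁ []
  findNeighbours {xs = x ∷ []} ([] ∷ []) = inj₁ ([] ∷ [])
  findNeighbours {xs = x ∷ y ∷ xs} ((inj₂ (e , x◃y) ∷ x≺) ∷ y≺ ∷ sorted) =
    inj₂ (neighbours x y xs e x◃y ↭-refl sorted (All.map inj₂ y≺))
  findNeighbours {xs = x ∷ y ∷ xs} ((inj₁ lt ∷ x≺) ∷ sorted@(_ ∷ _)) with findNeighbours sorted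
  ... | inj₁ (y< ∷ inc) = inj₁ ((lt ∷ All.map (ℕₚ.<-trans lt) y<) ∷ y< ∷ inc)
  ... | inj₂ (neighbours u v zs e u◃v σ sorted′ between) with All-resp-↭ σ (inj₁ lt ∷ x≺)
  ...   | x≺u ∷ _ ∷ x≺zs = inj₂ (neighbours u v (x ∷ zs) e u◃v
          (↭-trans (↭-prep x σ) (↭-trans (↭-swap x u) (↭-prep u (↭-swap x v))))
          (x≺zs ∷ sorted′) (inj₁ x≺u ∷ between))

-- Blowups with infinite blocks and subsets of the base tournament

Point : ℕ → Set
Point k = Fin k × ℕ

-- The blowup of R in which every block is an infinite transitive tournament.
ωblowup : ∀ {k} → Rel k → Point k → Point k → Bool
ωblowup R (i , x) (j , y) = if does (i Fin.≟ j) then x <ᵇ y else R i j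

<ᵇ-true : ∀ {m n} → m ℕ.< n → (m <ᵇ n) ≡ true
<ᵇ-true lt = Equivalence.to Boolₚ.T-≡ (ℕₚ.<⇒<ᵇ lt)

<ᵇ-false : ∀ {m n} → ¬ m ℕ.< n → (m <ᵇ n) ≡ false
<ᵇ-false {m} {n} ≮ with m <ᵇ n in eq
... | false = refl
... | true  = contradiction (ℕₚ.<ᵇ⇒< m n (subst Bool.T (sym eq) tt)) ≮

ωblowup-same : ∀ {k} (R : Rel k) {i j} → i ≡ j → ∀ x y → ωblowup R (i , x) (j , y) ≡ (x <ᵇ y)
ωblowup-same R {i} {j} i≡j x y rewrite dec-true (i Fin.≟ j) i≡j = refl

ωblowup-diff : ∀ {k} (R : Rel k) {i j} → i ≢ j → ∀ x y → ωblowup R (i , x) (j , y) ≡ R i j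
ωblowup-diff R {i} {j} i≢j x y rewrite dec-false (i Fin.≟ j) i≢j = refl

-- Rows and subsets are vectors: exhausting functions `Fin k → Bool` would require `P` to respect
-- pointwise equality.
allBits? : ∀ k {P : Vec Bool k → Set} → (∀ b → Dec (P b)) → Dec (∀ b → P b)
allBits? zero    P? = map′ (λ { p [] → p }) (λ f → f []) (P? [])
allBits? (suc k) P? = map′ (λ { (f , g) (true ∷ b) → f b ; (f , g) (false ∷ b) → g b })
  (λ h → (λ b → h (true ∷ b)) , (λ b → h (false ∷ b)))
  (allBits? k (λ b → P? (true ∷ b)) ×-dec allBits? k (λ b → P? (false ∷ b)))

members : ∀ {k} → Vec Bool k → Σ ℕ (Vec (Fin k))
members []          = 0 , []
members (true  ∷ b) = let (n , xs) = members b in suc n , zero ∷ Vec.map suc xs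
members (false ∷ b) = let (n , xs) = members b in n , Vec.map suc xs

Increasing : ∀ {k n} → Vec (Fin k) n → Set
Increasing = AllPairs Fin._<_

unsuc : ∀ {k n} {xs : Vec (Fin (suc k)) n} → All (zero {k} Fin.<_) xs → Increasing xs →
  Σ (Vec (Fin k) n) λ ys → xs ≡ Vec.map suc ys × Increasing ys
unsuc [] [] = [] , refl , []
unsuc {xs = zero ∷ _}  (() ∷ _)
unsuc {xs = suc x ∷ _} (_ ∷ pos) (x< ∷ inc) with unsuc pos inc
... | ys , refl , inc′ = x ∷ ys , refl , All.map ℕ.s<s⁻¹ (Allₚ.map⁻ x<) ∷ inc′

increasing⇒members : ∀ {k n} {xs : Vec (Fin k) n} → Increasing xs → Σ (Vec Bool k) λ b → members b ≡ (n , xs)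
increasing⇒members {zero}  {xs = []} [] = [] , refl
increasing⇒members {suc k} {xs = []} [] with increasing⇒members {k} {xs = []} []
... | b , eq = false ∷ b , cong (λ (n , xs) → n , Vec.map suc xs) eq
increasing⇒members {suc k} {xs = zero ∷ _} (pos ∷ inc) with unsuc pos inc
... | ys , refl , inc′ with increasing⇒members inc′
...   | b , eq = true ∷ b , cong (λ (n , xs) → suc n , zero ∷ Vec.map suc xs) eq
increasing⇒members {suc k} {xs = suc x ∷ _} (x< ∷ inc)
  with unsuc (All.map (ℕₚ.<-trans ℕₚ.0<1+n) x<) inc
... | ys , refl , inc′ with increasing⇒members (All.map ℕ.s<s⁻¹ (Allₚ.map⁻ x<) ∷ inc′)
...   | b , eq = false ∷ b , cong (λ (n , xs) → n , Vec.map suc xs) eq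

-- By `increasing⇒members`, the subsets listed in increasing order are all that the reduction of a
-- sorted list can end in. The empty subset, of determinant 1, is included because deleting pairs
-- may exhaust the list.
MembersBounded : ∀ {k} → Rel k → ℕ → Set
MembersBounded R K = ∀ b → detT (sub R (lookup (proj₂ (members b)))) ℤ.≤ + (K ℕ.* K)

module _ {k : ℕ} (R : Rel k) (irr : ∀ i → R i i ≡ false) where

  private
    _◃_ : Point k → Point k → Set
    p ◃ q = proj₂ p ℕ.< proj₂ q

    ◃-total : ∀ {p q : Point k} → proj₁ p ≡ proj₁ q → p ≢ q → p ◃ q ⊎ q ◃ p
    ◃-total {p} {q} e p≢q with ℕₚ.<-cmp (proj₂ p) (proj₂ q)
    ... | tri< lt _ _ = inj₁ lt
    ... | tri> _ _ gt = inj₂ gt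
    ... | tri≈ _ f _  = contradiction (cong₂ _,_ e f) p≢q

  open Lexicographic {A = Point k} proj₁ _◃_ (λ _ _ → ℕₚ.<-trans) ◃-total

  skewω : Point k → Point k → ℤ
  skewω p q = if ωblowup R p q then + 1 else (if ωblowup R q p then - (+ 1) else + 0)

  ωblowup-irrefl : ∀ p → ωblowup R p p ≡ false
  ωblowup-irrefl (i , x) = trans (ωblowup-same R refl x x) (<ᵇ-false (ℕₚ.n≮n x))

  skewω-cong : ∀ p q r s → ωblowup R p q ≡ ωblowup R r s → ωblowup R q p ≡ ωblowup R s r → skewω p q ≡ skewω r s
  skewω-cong p q r s eq eq′ rewrite eq | eq′ = refl

  -- A point of another block sees only the common label of `u` and `v`; a point of the same block
  -- lies below both or above both.
  outside : ∀ {u v} → proj₁ u ≡ proj₁ v → u ◃ v → ∀ {z} → z ≺ u ⊎ v ≺ z →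
    ωblowup R u z ≡ ωblowup R v z × ωblowup R z u ≡ ωblowup R z v
  outside {i , x} {.i , y} refl x<y {j , w} z with i Fin.≟ j | j Fin.≟ i
  outside {i , x} {.i , y} refl x<y {j , w} z | no _    | no _    = refl , refl
  outside {i , x} {.i , y} refl x<y {j , w} z | no i≢j  | yes j≡i = contradiction (sym j≡i) i≢j
  outside {i , x} {.i , y} refl x<y {j , w} z | yes i≡j | no j≢i  = contradiction (sym i≡j) j≢i
  outside {i , x} {.i , y} refl x<y {.i , w} (inj₁ (inj₁ lt)) | yes refl | yes _ = contradiction lt (ℕₚ.n≮n _)
  outside {i , x} {.i , y} refl x<y {.i , w} (inj₁ (inj₂ (_ , w<x))) | yes refl | yes _ =
    trans (<ᵇ-false (ℕₚ.<⇒≯ w<x)) (sym (<ᵇ-false (ℕₚ.<⇒≯ (ℕₚ.<-trans w<x x<y)))) ,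
    trans (<ᵇ-true w<x) (sym (<ᵇ-true (ℕₚ.<-trans w<x x<y)))
  outside {i , x} {.i , y} refl x<y {.i , w} (inj₂ (inj₁ lt)) | yes refl | yes _ = contradiction lt (ℕₚ.n≮n _)
  outside {i , x} {.i , y} refl x<y {.i , w} (inj₂ (inj₂ (_ , y<w))) | yes refl | yes _ =
    trans (<ᵇ-true (ℕₚ.<-trans x<y y<w)) (sym (<ᵇ-true y<w)) ,
    trans (<ᵇ-false (ℕₚ.<⇒≯ (ℕₚ.<-trans x<y y<w))) (sym (<ᵇ-false (ℕₚ.<⇒≯ y<w)))

  detOn-neighbours : ∀ {n} u v (zs : Vec (Point k) n) → proj₁ u ≡ proj₁ v → u ◃ v →
    All (λ z → z ≺ u ⊎ v ≺ z) zs → detOn skewω (u ∷ v ∷ zs) ≡ detOn skewω zs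
  detOn-neighbours {n} u v zs e u◃v between = det-twins n
    (λ r c → skewω (lookup (u ∷ v ∷ zs) r) (lookup (u ∷ v ∷ zs) c))
    (diagonal u) u→v v→u (diagonal v)
    (λ c → let (p , q) = outside e u◃v (Allₚ.lookup⁺ between c) in skewω-cong u (lookup zs c) v (lookup zs c) p q)
    (λ r → let (p , q) = outside e u◃v (Allₚ.lookup⁺ between r) in skewω-cong (lookup zs r) u (lookup zs r) v q p)
    where
    diagonal : ∀ p → skewω p p ≡ + 0
    diagonal p rewrite ωblowup-irrefl p = refl
    uv : ωblowup R u v ≡ true
    uv = trans (ωblowup-same R e (proj₂ u) (proj₂ v)) (<ᵇ-true u◃v)
    vu : ωblowup R v u ≡ false
    vu = trans (ωblowup-same R (sym e) (proj₂ v) (proj₂ u)) (<ᵇ-false (ℕₚ.<⇒≯ u◃v))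
    u→v : skewω u v ≡ + 1
    u→v rewrite uv = refl
    v→u : skewω v u ≡ - + 1
    v→u rewrite vu | uv = refl

  -- Points of distinct blocks are compared by `R` alone, so the heights drop out.
  detOn-transversal : ∀ {n} (xs : Vec (Point k) n) → AllPairs (Fin._<_ on proj₁) xs →
    detOn skewω xs ≡ detT (sub R (lookup (Vec.map proj₁ xs)))
  detOn-transversal {n} xs inc = det-cong n entry
    where
    sameArc : ∀ r c → ωblowup R (lookup xs r) (lookup xs c) ≡ sub R (lookup (Vec.map proj₁ xs)) r c
    sameArc r c rewrite Vecₚ.lookup-map r proj₁ xs | Vecₚ.lookup-map c proj₁ xs with Finₚ.<-cmp r c
    ... | tri≈ _ refl _ = trans (ωblowup-irrefl (lookup xs r)) (sym (irr _))
    ... | tri< r<c _ _  = ωblowup-diff R (λ e → ℕₚ.<⇒≢ (AllPairs-lookup inc r<c) (cong toℕ e))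
      (proj₂ (lookup xs r)) (proj₂ (lookup xs c))
    ... | tri> _ _ c<r  = ωblowup-diff R (λ e → ℕₚ.<⇒≢ (AllPairs-lookup inc c<r) (cong toℕ (sym e)))
      (proj₂ (lookup xs r)) (proj₂ (lookup xs c))
    entry : ∀ r c → skewω (lookup xs r) (lookup xs c) ≡ skew (sub R (lookup (Vec.map proj₁ xs))) r c
    entry r c rewrite sameArc r c | sameArc c r = refl

  detOn-sorted≤ : ∀ {K} → MembersBounded R K → ∀ n {xs : Vec (Point k) n} → AllPairs _≺_ xs →
    detOn skewω xs ℤ.≤ + (K ℕ.* K)
  detOn-sorted≤ bounded n {xs} sorted with findNeighbours sorted
  detOn-sorted≤ {K} bounded n {xs} sorted | inj₁ inc with increasing⇒members (AllPairsₚ.map⁺ inc)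
  ... | b , eq = subst (ℤ._≤ + (K ℕ.* K))
    (trans (cong (λ (n , ys) → detT (sub R (lookup ys))) eq) (sym (detOn-transversal xs inc)))
    (bounded b)
  detOn-sorted≤ {K} bounded (suc (suc n)) {xs} sorted | inj₂ (neighbours u v zs e u◃v σ sorted′ between) =
    subst (ℤ._≤ + (K ℕ.* K)) (sym (trans (detOn-↭ skewω σ) (detOn-neighbours u v zs e u◃v between)))
      (detOn-sorted≤ {K} bounded n sorted′)

  detOn≤ : ∀ {K n} {xs : Vec (Point k) n} → MembersBounded R K → AllPairs _≢_ xs → detOn skewω xs ℤ.≤ + (K ℕ.* K)
  detOn≤ {K} {n} bounded distinct with sort distinct
  ... | ys , σ , sorted = subst (ℤ._≤ + (K ℕ.* K)) (sym (detOn-↭ skewω σ)) (detOn-sorted≤ {K} bounded n sorted)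

  SwBlowup⇒InD : ∀ {K n} {T : Rel n} → MembersBounded R K → IsTournament T → SwBlowup T R → InD K T
  SwBlowup⇒InD {K} {n} {T} bounded t (W , a , _ , φ , iso) = InD-unswitch {K} t W λ m f inj →
    subst (ℤ._≤ + (K ℕ.* K))
      (det-cong (suc m) λ r c → trans
        (cong₂ skewω (Vecₚ.lookup∘tabulate (point ∘ f) r) (Vecₚ.lookup∘tabulate (point ∘ f) c))
        (skewω-switch (f r) (f c)))
      (detOn≤ {K} bounded (AllPairsₚ.tabulate⁺ λ i≢j → i≢j ∘ inj ∘ point-injective))
    where
    point : Fin n → Point k
    point u = let (i , x) = Bijection.to φ u in i , toℕ x
    point-injective : Injective _≡_ _≡_ point
    point-injective {u} {v} eq = Bijection.injective φ (lift (cong proj₁ eq) (cong proj₂ eq))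
      where
      lift : ∀ {p q : BlowupV a} → proj₁ p ≡ proj₁ q → toℕ (proj₂ p) ≡ toℕ (proj₂ q) → p ≡ q
      lift refl e = cong (_ ,_) (Finₚ.toℕ-injective e)
    skewω-switch : ∀ u v → skewω (point u) (point v) ≡ skew (switch T W) u v
    skewω-switch u v rewrite iso u v | iso v u = refl

-- Since no block is empty, the first vertices of the blocks form a copy of `R` in the switched
-- tournament, to which `InD K` passes.
SwBlowup⇒¬InD : ∀ {K k n} {R : Rel (suc k)} {T : Rel n} → IsTournament R → Exceeds K R →
  IsTournament T → SwBlowup T R → ¬ InD K T
SwBlowup⇒¬InD {K} {k} {n} {R} {T} r large t (W , a , a≥1 , φ , iso) d =
  copy-exceeds large (switch-isTournament t W) r copy (InD-switch {K} t W d)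
  where
  first : ∀ i → BlowupV a
  first i = i , Fin.fromℕ< (a≥1 i)
  e : Fin (suc k) → Fin n
  e i = Bijection.to⁻ φ (first i)
  to-e : ∀ i → Bijection.to φ (e i) ≡ first i
  to-e i = proj₂ (Bijection.strictlySurjective φ (first i))
  copy : Copy (switch T W) R e
  copy .Copy.arc i j rewrite iso (e i) (e j) | to-e i | to-e j with i Fin.≟ j
  ... | yes refl = trans (<ᵇ-false (ℕₚ.n≮n (toℕ (proj₂ (first i))))) (sym (irrefl r i))
  ... | no  _    = refl

-- Recognising blowups

AllPairs-fromList : ∀ {A : Set} {R : A → A → Set} {xs : List A} →
  ListAllPairs.AllPairs R xs → AllPairs R (Vec.fromList xs)
AllPairs-fromList ListAllPairs.[]       = []
AllPairs-fromList (p ListAllPairs.∷ ps) = Allₚ.fromList⁺ p ∷ AllPairs-fromList ps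

arc-flip : ∀ {n} {X : Rel n} → IsTournament X → ∀ {u v} → X u v ≡ true → X v u ≡ false
arc-flip {X = X} t {u} {v} uv with u Fin.≟ v
... | yes refl = irrefl t u
... | no  u≢v  = trans (oneArc t v u (u≢v ∘ sym)) (cong not uv)

module _ {n m} {X : Rel n} (t : IsTournament X) (R : Rel m) (ℓ : Fin n → Fin m)
  (surjective : ∀ i → ∃ λ u → ℓ u ≡ i)
  (cross : ∀ u v → ℓ u ≢ ℓ v → X u v ≡ R (ℓ u) (ℓ v))
  (acyclic : ∀ {u v w} → ℓ u ≡ ℓ v → ℓ v ≡ ℓ w → X u v ≡ true → X v w ≡ true → X w u ≡ true → ⊥) where

  private
    _◃_ : Fin n → Fin n → Set
    u ◃ v = X u v ≡ true

    ◃-total : ∀ {u v} → ℓ u ≡ ℓ v → u ≢ v → u ◃ v ⊎ v ◃ u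
    ◃-total {u} {v} _ u≢v with X u v in uv
    ... | true  = inj₁ refl
    ... | false = inj₂ (trans (oneArc t v u (u≢v ∘ sym)) (cong not uv))

    -- A failure of transitivity would close a cyclic triangle inside a class or, when `u` and `w`
    -- coincide, give a pair of opposite arcs.
    ◃-trans : ∀ {u v w} → ℓ u ≡ ℓ v → ℓ v ≡ ℓ w → u ◃ v → v ◃ w → u ◃ w
    ◃-trans {u} {v} {w} e f uv vw with u Fin.≟ w
    ... | yes refl = contradiction (trans (sym vw) (arc-flip t uv)) λ ()
    ... | no  u≢w with ◃-total (trans e f) u≢w
    ...   | inj₁ uw = uw
    ...   | inj₂ wu = contradiction wu (acyclic e f uv vw)

    open Lexicographic ℓ _◃_ ◃-trans ◃-total

    class : Fin m → List (Fin n)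
    class i = List.filter (λ u → ℓ u Fin.≟ i) (List.allFin n)

    size : Fin m → ℕ
    size i = List.length (class i)

    sortedClass : ∀ i → Σ (Vec (Fin n) (size i)) λ ys → Vec.fromList (class i) ↭ ys × AllPairs _≺_ ys
    sortedClass i = sort (AllPairs-fromList (Uniqueₚ.filter⁺ (λ u → ℓ u Fin.≟ i) (Uniqueₚ.allFin⁺ n)))

    block : ∀ i → Vec (Fin n) (size i)
    block i = proj₁ (sortedClass i)

    vertex : BlowupV size → Fin n
    vertex (i , x) = lookup (block i) x

    ℓ-vertex : ∀ p → ℓ (vertex p) ≡ proj₁ p
    ℓ-vertex (i , x) = Allₚ.lookup⁺
      (All-resp-↭ (proj₁ (proj₂ (sortedClass i)))
        (Allₚ.fromList⁺ (ListAllₚ.all-filter (λ u → ℓ u Fin.≟ i) (List.allFin n)))) x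

    member : ∀ u → u ∈ block (ℓ u)
    member u = Any-resp-↭ (proj₁ (proj₂ (sortedClass (ℓ u))))
      (∈-fromList⁺ (∈-filter⁺ (λ v → ℓ v Fin.≟ ℓ u) (∈-allFin u) refl))

    position : Fin n → BlowupV size
    position u = ℓ u , Any.index (member u)

    vertex-position : ∀ u → vertex (position u) ≡ u
    vertex-position u = sym (Anyₚ.lookup-index (member u))

    forward : ∀ {i} {x y : Fin (size i)} → x Fin.< y → X (vertex (i , x)) (vertex (i , y)) ≡ true
    forward {i} {x} {y} x<y with AllPairs-lookup (proj₂ (proj₂ (sortedClass i))) x<y
    ... | inj₂ (_ , xy) = xy
    ... | inj₁ lt = contradiction (cong toℕ (trans (ℓ-vertex (i , x)) (sym (ℓ-vertex (i , y))))) (ℕₚ.<⇒≢ lt)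

    arcs-in-block : ∀ {i j} → i ≡ j → ∀ x y → X (vertex (i , x)) (vertex (j , y)) ≡ (toℕ x <ᵇ toℕ y)
    arcs-in-block refl x y with Finₚ.<-cmp x y
    ... | tri< x<y _ _    = trans (forward x<y) (sym (<ᵇ-true x<y))
    ... | tri≈ x≮x refl _ = trans (irrefl t _) (sym (<ᵇ-false x≮x))
    ... | tri> x≮y _ y<x  = trans (arc-flip t (forward y<x)) (sym (<ᵇ-false x≮y))

    vertex-injective : ∀ {i} {x y : Fin (size i)} → vertex (i , x) ≡ vertex (i , y) → x ≡ y
    vertex-injective {i} {x} {y} eq with Finₚ.<-cmp x y
    ... | tri≈ _ x≡y _ = x≡y
    ... | tri< x<y _ _ = contradiction
      (trans (sym (forward x<y)) (trans (cong (X _) (sym eq)) (irrefl t (vertex (i , x))))) λ ()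
    ... | tri> _ _ y<x = contradiction
      (trans (sym (forward y<x)) (trans (cong (X _) eq) (irrefl t (vertex (i , y))))) λ ()

    position-unique : ∀ {u i} x → ℓ u ≡ i → vertex (i , x) ≡ u → position u ≡ (i , x)
    position-unique {u} x refl eq = cong (ℓ u ,_) (vertex-injective (trans (vertex-position u) (sym eq)))

    arcs : ∀ u v → X u v ≡ blowup R size (position u) (position v)
    arcs u v with ℓ u Fin.≟ ℓ v
    ... | no  ℓu≢ℓv = cross u v ℓu≢ℓv
    ... | yes ℓu≡ℓv = trans (cong₂ X (sym (vertex-position u)) (sym (vertex-position v)))
      (arcs-in-block ℓu≡ℓv (Any.index (member u)) (Any.index (member v)))

    nonempty : ∀ i → 1 ℕ.≤ size i
    nonempty i with surjective i
    ... | u , refl = ℕₚ.≤-trans (ℕ.s≤s ℕ.z≤n) (Finₚ.toℕ<n (Any.index (member u)))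

  -- Each class, sorted along its arcs, becomes a block, and a vertex is sent to its label and its
  -- place in that list. Arcs between blocks come from `cross`, and `surjective` makes the blocks
  -- nonempty.
  labelling⇒blowup : Σ (Fin m → ℕ) λ a → (∀ i → 1 ℕ.≤ a i) × IsoBlowup X R a
  labelling⇒blowup = size , nonempty , mk⤖
    ( (λ {u} {v} eq → trans (sym (vertex-position u)) (trans (cong vertex eq) (vertex-position v)))
    , strictlySurjective⇒surjective λ p → vertex p , position-unique (proj₂ p) (ℓ-vertex p) refl ) , arcs

-- Finite verifications

allBit? : {P : Bool → Set} → (∀ s → Dec (P s)) → Dec (∀ s → P s)
allBit? P? = map′ (λ { (p , q) true → p ; (p , q) false → q }) (λ f → f true , f false)
  (P? true ×-dec P? false)

anyBit? : {P : Bool → Set} → (∀ s → Dec (P s)) → Dec (∃ P)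
anyBit? P? = map′ (λ { (inj₁ p) → true , p ; (inj₂ p) → false , p })
  (λ { (true , p) → inj₁ p ; (false , p) → inj₂ p }) (P? true ⊎-dec P? false)

membersBounded? : ∀ {k} (R : Rel k) K → Dec (MembersBounded R K)
membersBounded? {k} R K = allBits? k λ b → detT (sub R (lookup (proj₂ (members b)))) ℤₚ.≤? + (K ℕ.* K)

-- b is, up to the global sign s, the row of a twin of vertex i; b i itself is free.
Matches : ∀ {k} → Rel k → (Fin k → Bool) → Fin k → Bool → Set
Matches R b i s = ∀ j → i ≢ j → b j ≡ R i j xor s

matches? : ∀ {k} (R : Rel k) b i s → Dec (Matches R b i s)
matches? R b i s = all? λ j → ¬? (i Fin.≟ j) →-dec (b j Bool.≟ (R i j xor s))

-- Whichever match a search returns, this forces the vertices of a copy of `R` to be labelled by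
-- themselves and without sign, so that switching by the signs leaves the copy in place.
MatchesItself : ∀ {k} → Rel k → Set
MatchesItself R = ∀ i i′ s → Matches R (R i) i′ s → i′ ≡ i × s ≡ false

matchesItself? : ∀ {k} (R : Rel k) → Dec (MatchesItself R)
matchesItself? R = all? λ i → all? λ i′ → allBit? λ s →
  matches? R (R i) i′ s →-dec ((i′ Fin.≟ i) ×-dec (s Bool.≟ false))

twinRow : ∀ {k} → Rel k → Fin k → Bool → Fin k → Bool
twinRow R i s j = if does (i Fin.≟ j) then s else R i j

-- R together with a twin of i and a twin of j, the arc between the two twins being wrong.
crossing : ∀ {k} → Rel k → Fin k → Fin k → Bool → Bool → Rel (suc (suc k))
crossing R i j s s′ = cone (cone R (twinRow R j s′)) (not (R i j) VF.∷ twinRow R i s)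

crossing-isTournament : ∀ {k} {R : Rel k} → IsTournament R → ∀ i j s s′ → IsTournament (crossing R i j s s′)
crossing-isTournament r i j s s′ = cone-isTournament (cone-isTournament r _) _

-- A cyclic triangle of twins of i, together with the vertices js of R.
triangle : ∀ {k} → Rel k → (Fin 3 → Fin k) → Fin k → Rel 6
triangle R js i = cone (cone (cone (sub R js) bs) (true VF.∷ bs)) (true VF.∷ false VF.∷ bs)
  where bs = R i ∘ js

triangle-isTournament : ∀ {k} {R : Rel k} {js i} → IsTournament (sub R js) → IsTournament (triangle R js i)
triangle-isTournament r = cone-isTournament (cone-isTournament (cone-isTournament r _) _) _

permutations : ∀ n → List (Vec (Fin n) n)
permutations zero    = [] ∷ []
permutations (suc n) =
  List.concatMap (λ i → List.map (λ p → i ∷ Vec.map (punchIn i) p) (permutations n)) (List.allFin (suc n))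

-- The switching that would make the pattern Q, listed in the order p, agree with L 6 in row 0.
aligning : Rel 6 → Vec (Fin 6) 6 → Fin 6 → Bool
aligning Q p c = sub Q (lookup p) zero c xor L 6 zero c

-- Row 0 determines the switching set up to complement, and complementary sets switch alike, so each
-- order `p` leaves a single candidate to test.
IsL₆ : Rel 6 → Vec (Fin 6) 6 → Set
IsL₆ Q p = ∀ a b → sub Q (lookup p) a b ≡ switch (L 6) (aligning Q p) a b

isL₆? : ∀ Q p → Dec (IsL₆ Q p)
isL₆? Q p = all? λ a → all? λ b → sub Q (lookup p) a b Bool.≟ switch (L 6) (aligning Q p) a b

-- Three vertices forming a diamond with i, up to switching.
others : Fin 6 → Vec (Fin 6) 3
others = lookup ((# 1 ∷ # 2 ∷ # 5 ∷ []) ∷ (# 0 ∷ # 2 ∷ # 5 ∷ []) ∷ (# 0 ∷ # 1 ∷ # 5 ∷ []) ∷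
  (# 0 ∷ # 4 ∷ # 5 ∷ []) ∷ (# 0 ∷ # 1 ∷ # 5 ∷ []) ∷ (# 0 ∷ # 1 ∷ # 2 ∷ []) ∷ [])

-- Opaque, because unfolding a decision procedure on symbolic arguments explodes.
abstract

  L₂-irrefl : ∀ i → L 2 i i ≡ false
  L₂-irrefl = from-yes (all? λ i → L 2 i i Bool.≟ false)

  L₄-isTournament : IsTournament (L 4)
  L₄-isTournament = from-yes (isTournament? (L 4))

  L₆-isTournament : IsTournament (L 6)
  L₆-isTournament = from-yes (isTournament? (L 6))

  L₂-bounded : MembersBounded (L 2) 1
  L₂-bounded = from-yes (membersBounded? (L 2) 1)

  L₄-bounded : MembersBounded (L 4) 3
  L₄-bounded = from-yes (membersBounded? (L 4) 3)

  L₆-bounded : MembersBounded (L 6) 5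
  L₆-bounded = from-yes (membersBounded? (L 6) 5)

  L₄-exceeds : Exceeds 1 (L 4)
  L₄-exceeds = from-yes (exceeds? 1 (L 4))

  L₆-exceeds : Exceeds 3 (L 6)
  L₆-exceeds = from-yes (exceeds? 3 (L 6))

  -- The count is exact: each of the four vertices accounts for four rows, through its free entry
  -- and the sign, and there are 16 rows.
  L₄-matches : ∀ (b : Vec Bool 4) → ∃₂ (Matches (L 4) (lookup b))
  L₄-matches = from-yes (allBits? 4 λ b → any? λ i → anyBit? (matches? (L 4) (lookup b) i))

  -- At most 24 of the 64 rows can match. All seven vertices together have determinant 0, the order
  -- being odd, so a large determinant is sought after deleting one vertex of `L 6`; the `suc` in
  -- `punchIn (suc r)` protects the new vertex.
  L₆-matches : ∀ (b : Vec Bool 6) → ∃₂ (Matches (L 6) (lookup b)) ⊎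
    ∃ λ r → Exceeds 5 (sub (cone (L 6) (lookup b)) (punchIn (suc r)))
  L₆-matches = from-yes (allBits? 6 λ b → (any? λ i → anyBit? (matches? (L 6) (lookup b) i)) ⊎-dec
    (any? λ r → exceeds? 5 (sub (cone (L 6) (lookup b)) (punchIn (suc r)))))

  L₄-matchesItself : MatchesItself (L 4)
  L₄-matchesItself = from-yes (matchesItself? (L 4))

  L₆-matchesItself : MatchesItself (L 6)
  L₆-matchesItself = from-yes (matchesItself? (L 6))

  others-valid : ∀ i → (∀ a → i ≢ lookup (others i) a) × IsTournament (sub (L 6) (lookup (others i)))
  others-valid = from-yes (all? λ i →
    (all? λ a → ¬? (i Fin.≟ lookup (others i) a)) ×-dec isTournament? (sub (L 6) (lookup (others i))))

  L₄-triangle : ∀ i → Exceeds 5 (triangle (L 4) (punchIn i) i)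
  L₄-triangle = from-yes (all? λ i → exceeds? 5 (triangle (L 4) (punchIn i) i))

  L₆-triangle : ∀ i → Exceeds 5 (triangle (L 6) (lookup (others i)) i)
  L₆-triangle = from-yes (all? λ i → exceeds? 5 (triangle (L 6) (lookup (others i)) i))

  L₄-crossing : ∀ i j → i Fin.< j → ∀ s s′ → Exceeds 5 (crossing (L 4) i j s s′) ⊎
    ∃ (IsL₆ (crossing (L 4) i j s s′))
  L₄-crossing i j i<j s s′ = Sum.map₂ ListAny.satisfied (search i j i<j s s′)
    where
    search : ∀ i j → i Fin.< j → ∀ s s′ → Exceeds 5 (crossing (L 4) i j s s′) ⊎
      ListAny.Any (IsL₆ (crossing (L 4) i j s s′)) (permutations 6)
    search = from-yes (all? λ i → all? λ j → (i Fin.<? j) →-dec allBit? λ s → allBit? λ s′ →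
      exceeds? 5 (crossing (L 4) i j s s′) ⊎-dec
      ListAny.any? (isL₆? (crossing (L 4) i j s s′)) (permutations 6))

-- Pairs of vertices of L 6; the consecutive ones come first because deleting them is
-- most often sufficient.
deletions : List (Fin 5 × Fin 6)
deletions = (# 0 , # 1) ∷ (# 1 , # 2) ∷ (# 2 , # 3) ∷ (# 3 , # 4) ∷ (# 0 , # 4) ∷
  (# 0 , # 2) ∷ (# 0 , # 3) ∷ (# 1 , # 3) ∷ (# 1 , # 4) ∷ (# 2 , # 4) ∷ []

-- Indices 0 and 1 of a crossing are the two twins, hence the shift by two. As the first entry of
-- each listed pair is the smaller, the composite omits exactly the vertices `x` and `y` of `L 6`.
deleting : Fin 5 × Fin 6 → Fin 6 → Fin 8
deleting (x , y) = punchIn (suc (suc y)) ∘ punchIn (suc (suc x))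

abstract

  -- The second alternative is needed only for crossings that are switching equivalent to L 8,
  -- of determinant 49.
  L₆-crossing : ∀ i j → i Fin.< j → ∀ s s′ →
    ∃ (λ xy → Exceeds 5 (sub (crossing (L 6) i j s s′) (deleting xy))) ⊎ Exceeds 5 (crossing (L 6) i j s s′)
  L₆-crossing i j i<j s s′ = Sum.map₁ ListAny.satisfied (search i j i<j s s′)
    where
    search : ∀ i j → i Fin.< j → ∀ s s′ →
      ListAny.Any (λ xy → Exceeds 5 (sub (crossing (L 6) i j s s′) (deleting xy))) deletions ⊎
      Exceeds 5 (crossing (L 6) i j s s′)
    search = from-yes (all? λ i → all? λ j → (i Fin.<? j) →-dec allBit? λ s → allBit? λ s′ →
      ListAny.any? (λ xy → exceeds? 5 (sub (crossing (L 6) i j s s′) (deleting xy))) deletions ⊎-dec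
      exceeds? 5 (crossing (L 6) i j s s′))

-- Copies of L 4 and L 6

copy-switched : ∀ {n m} {X : Rel n} {P : Rel m} {e W} → IsTournament X → IsTournament P →
  Copy X (switch P W) e → ∃ λ V → Copy (switch X V) P e
copy-switched {X = X} {P} {e} {W} t p c = extend e W , record { arc = λ i j → begin
  X (e i) (e j) xor (extend e W (e i) xor extend e W (e j))
    ≡⟨ cong₂ (λ a b → a xor b) (arc c i j) (cong₂ _xor_ (extend-at inj W i) (extend-at inj W j)) ⟩
  (P i j xor (W i xor W j)) xor (W i xor W j)
    ≡⟨ Boolₚ.xor-assoc (P i j) _ _ ⟩
  P i j xor ((W i xor W j) xor (W i xor W j))
    ≡⟨ cong (P i j xor_) (Boolₚ.xor-same (W i xor W j)) ⟩
  P i j xor false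
    ≡⟨ Boolₚ.xor-identityʳ (P i j) ⟩
  P i j ∎ }
  where
  open ≡-Reasoning
  inj = copy-injective t (switch-isTournament p W) c

-- This is the situation after switching by the signs: every vertex is a genuine twin of the vertex
-- of the copy that carries its label, the arc between these two being free. It remains to compare
-- such twins with one another.
module Attached {k n} {R : Rel k} (r : IsTournament R) {X : Rel n} (t : IsTournament X) {e : Fin k → Fin n}
  (c : Copy X R e) (ℓ : Fin n → Fin k) (ℓ-e : ∀ i → ℓ (e i) ≡ i)
  (adjacent : ∀ w j → ℓ w ≢ j → X w (e j) ≡ R (ℓ w) j) where

  adjacent′ : ∀ w j → ℓ w ≢ j → X (e j) w ≡ R j (ℓ w)
  adjacent′ w j ne = begin
    X (e j) w       ≡⟨ oneArc t (e j) w (λ { refl → ne (ℓ-e j) }) ⟩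
    not (X w (e j)) ≡⟨ cong not (adjacent w j ne) ⟩
    not (R (ℓ w) j) ≡⟨ sym (oneArc r j (ℓ w) (ne ∘ sym)) ⟩
    R j (ℓ w)       ∎
    where open ≡-Reasoning

  twin : ∀ w j → X w (e j) ≡ twinRow R (ℓ w) (X w (e (ℓ w))) j
  twin w j with ℓ w Fin.≟ j
  ... | yes refl = refl
  ... | no ne    = adjacent w j ne

  copy-crossing : ∀ {u v} → ℓ u ≢ ℓ v → X u v ≢ R (ℓ u) (ℓ v) →
    Copy X (crossing R (ℓ u) (ℓ v) (X u (e (ℓ u))) (X v (e (ℓ v)))) (u VF.∷ v VF.∷ e)
  copy-crossing {u} {v} ne wrong = copy-cone t (copy-cone t c fresh-v (twin v)) fresh-u bits
    where
    -- If `u` or `v` belonged to the copy, `adjacent` or `adjacent′` would make the arc between them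
    -- correct.
    fresh-v : ∀ i → v ≢ e i
    fresh-v i refl = wrong (trans (adjacent u i (λ eq → ne (trans eq (sym (ℓ-e i))))) (cong (R (ℓ u)) (sym (ℓ-e i))))
    fresh-u : ∀ i → u ≢ (v VF.∷ e) i
    fresh-u zero    refl = ne refl
    fresh-u (suc i) refl = wrong (trans
      (adjacent′ v i (λ eq → ne (trans (ℓ-e i) (sym eq)))) (cong (λ j → R j (ℓ v)) (sym (ℓ-e i))))
    bits : ∀ i → X u ((v VF.∷ e) i) ≡ (not (R (ℓ u) (ℓ v)) VF.∷ twinRow R (ℓ u) (X u (e (ℓ u)))) i
    bits zero    = Boolₚ.¬-not wrong
    bits (suc i) = twin u i

  -- The list `js` avoids `i`, the one place where twins of `i` may differ, so the three vertices
  -- have the same row on it.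
  copy-triangle : ∀ {i} js → (∀ a → i ≢ js a) → ∀ {u v w} → ℓ u ≡ i → ℓ v ≡ i → ℓ w ≡ i →
    X u v ≡ true → X v w ≡ true → X w u ≡ true → Copy X (triangle R js i) (u VF.∷ v VF.∷ w VF.∷ e ∘ js)
  copy-triangle {i} js i∉ {u} {v} {w} ℓu ℓv ℓw uv vw wu =
    copy-cone t (copy-cone t (copy-cone t (copy-sub {e = e} c js) (fresh ℓw) (bits ℓw))
      (λ { zero eq → distinct vw eq ; (suc a) → fresh ℓv a }) (λ { zero → vw ; (suc a) → bits ℓv a }))
      (λ { zero eq → distinct uv eq ; (suc zero) eq → distinct wu (sym eq) ; (suc (suc a)) → fresh ℓu a })
      (λ { zero → uv ; (suc zero) → arc-flip t wu ; (suc (suc a)) → bits ℓu a })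
    where
    fresh : ∀ {x} → ℓ x ≡ i → ∀ a → x ≢ e (js a)
    fresh ℓx a refl = i∉ a (trans (sym ℓx) (ℓ-e (js a)))
    bits : ∀ {x} → ℓ x ≡ i → ∀ a → X x (e (js a)) ≡ R i (js a)
    bits {x} refl a = adjacent x (js a) (i∉ a)
    distinct : ∀ {x y} → X x y ≡ true → x ≢ y
    distinct xy refl = contradiction (trans (sym xy) (irrefl t _)) λ ()

  -- Increasing labels halve the finite checks; `uncrossed` recovers the other order by reversing
  -- the arcs on both sides.
  Crossed : Fin n → Fin n → Set
  Crossed u v = ℓ u Fin.< ℓ v × X u v ≢ R (ℓ u) (ℓ v)

  crossed? : Dec (∃₂ Crossed)
  crossed? = any? λ u → any? λ v → (ℓ u Fin.<? ℓ v) ×-dec ¬? (X u v Bool.≟ R (ℓ u) (ℓ v))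

  uncrossed : ¬ ∃₂ Crossed → ∀ u v → ℓ u ≢ ℓ v → X u v ≡ R (ℓ u) (ℓ v)
  uncrossed none u v ne with Finₚ.<-cmp (ℓ u) (ℓ v)
  ... | tri≈ _ eq _ = contradiction eq ne
  ... | tri< lt _ _ = increasing lt
    where
    increasing : ∀ {u v} → ℓ u Fin.< ℓ v → X u v ≡ R (ℓ u) (ℓ v)
    increasing {u} {v} lt with X u v Bool.≟ R (ℓ u) (ℓ v)
    ... | yes eq = eq
    ... | no neq = contradiction (u , v , lt , neq) none
  ... | tri> _ _ gt with X v u Bool.≟ R (ℓ v) (ℓ u)
  ...   | no neq = contradiction (v , u , gt , neq) none
  ...   | yes eq = trans (oneArc t u v λ { refl → ne refl }) (trans (cong not eq) (sym (oneArc r (ℓ u) (ℓ v) ne)))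

  uncrossed⇒blowup : ∀ {K} → InD K X →
    (∀ i → ∃ λ js → (∀ a → i ≢ js a) × IsTournament (sub R js) × Exceeds K (triangle R js i)) →
    ¬ ∃₂ Crossed → Σ (Fin k → ℕ) λ a → (∀ i → 1 ≤ a i) × IsoBlowup X R a
  uncrossed⇒blowup {K} d large none = labelling⇒blowup t R ℓ (λ i → e i , ℓ-e i) (uncrossed none)
    λ {u} uv vw x y z → let (js , i∉ , p , big) = large (ℓ u) in
      copy-exceeds big t (triangle-isTournament {R = R} {js} {ℓ u} p)
        (copy-triangle js i∉ refl (sym uv) (sym (trans uv vw)) x y z) d

module Labels {k n} {R : Rel k} {X : Rel n} {e : Fin k → Fin n} (c : Copy X R e)
  (match : ∀ w → ∃₂ (Matches R (λ j → X w (e j))))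
  (own : MatchesItself R) where

  label : Fin n → Fin k
  label w = proj₁ (match w)

  flipped : Fin n → Bool
  flipped w = proj₁ (proj₂ (match w))

  normal : Rel n
  normal = switch X flipped

  own-e : ∀ i → label (e i) ≡ i × flipped (e i) ≡ false
  own-e i = own i _ _ λ j ne → trans (sym (arc c i j)) (proj₂ (proj₂ (match (e i))) j ne)

  normal-copy : Copy normal R e
  normal-copy .arc i j rewrite proj₂ (own-e i) | proj₂ (own-e j) = trans (Boolₚ.xor-identityʳ _) (arc c i j)

  -- The switching cancels the sign of `w`, while by `own-e` no vertex of the copy is flipped.
  adjacent : ∀ w j → label w ≢ j → normal w (e j) ≡ R (label w) j
  adjacent w j ne rewrite proj₂ (own-e j) | proj₂ (proj₂ (match w)) j ne = cancel (R (label w) j) (flipped w)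
    where
    cancel : ∀ a s → (a xor s) xor (s xor false) ≡ a
    cancel true  true  = refl
    cancel true  false = refl
    cancel false true  = refl
    cancel false false = refl

HasCopy : ∀ {n m} → Rel n → Rel m → Set
HasCopy T R = ∃₂ λ W e → Copy (switch T W) R e

HasCopy-unswitch : ∀ {n m} {T : Rel n} {R : Rel m} W → HasCopy (switch T W) R → HasCopy T R
HasCopy-unswitch {T = T} W (V , e , c) =
  (λ v → W v xor V v) , e , record { arc = λ i j → trans (switch-switch T W V (e i) (e j)) (arc c i j) }

SwBlowup-unswitch : ∀ {n m} {T : Rel n} {R : Rel m} W → SwBlowup (switch T W) R → SwBlowup T R
SwBlowup-unswitch {T = T} W (V , a , a≥1 , φ , iso) =
  (λ v → W v xor V v) , a , a≥1 , φ , λ u v → trans (switch-switch T W V u v) (iso u v)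

Matches-cong : ∀ {k} {R : Rel k} {b b′ i s} → (∀ j → b j ≡ b′ j) → Matches R b i s → Matches R b′ i s
Matches-cong eq match j ne = trans (sym (eq j)) (match j ne)

deleting-injective : ∀ xy → Injective _≡_ _≡_ (deleting xy)
deleting-injective (x , y) eq =
  Finₚ.punchIn-injective (suc (suc x)) _ _ (Finₚ.punchIn-injective (suc (suc y)) _ _ eq)

InD5⇒L4-blowup⊎L6-copy : ∀ {n} {T : Rel n} → IsTournament T → InD 5 T → HasCopy T (L 4) →
  SwBlowup T (L 4) ⊎ HasCopy T (L 6)
InD5⇒L4-blowup⊎L6-copy {n} {T} t d (W , e , c) = result crossed?
  where
  X = switch T W
  match : ∀ w → ∃₂ (Matches (L 4) (λ j → X w (e j)))
  match w with L₄-matches (tabulate (λ j → X w (e j)))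
  ... | i , s , m = i , s , Matches-cong {R = L 4} (Vecₚ.lookup∘tabulate (λ j → X w (e j))) m
  open Labels {R = L 4} {X = X} c match L₄-matchesItself
  x′ = switch-isTournament (switch-isTournament t W) flipped
  d′ : InD 5 normal
  d′ = InD-switch {5} {T = X} (switch-isTournament t W) flipped (InD-switch {5} {T = T} t W d)
  open Attached L₄-isTournament x′ normal-copy label (proj₁ ∘ own-e) adjacent
  unswitch : ∀ {m} {R : Rel m} → HasCopy normal R → HasCopy T R
  unswitch {R = R} h = HasCopy-unswitch {T = T} {R} W (HasCopy-unswitch {T = X} {R} flipped h)
  large : ∀ i → ∃ λ js → (∀ a → i ≢ js a) × IsTournament (sub (L 4) js) × Exceeds 5 (triangle (L 4) js i)
  large i = punchIn i , (λ a → Finₚ.punchInᵢ≢i i a ∘ sym) ,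
    sub-isTournament {f = punchIn i} (Finₚ.punchIn-injective i _ _) L₄-isTournament , L₄-triangle i
  result : Dec (∃₂ Crossed) → SwBlowup T (L 4) ⊎ HasCopy T (L 6)
  result (no none) = inj₁ (SwBlowup-unswitch {T = T} {L 4} W (flipped , uncrossed⇒blowup {5} d′ large none))
  result (yes (u , v , lt , wrong)) =
    [ (λ big → contradiction d′ (copy-exceeds big x′ (crossing-isTournament L₄-isTournament i j s s′) q))
    -- Listed in the order `p`, the crossing is a switching of `L 6`, which a switching `V` of the
    -- host undoes. The switchings by `flipped` and `W` are then absorbed by `unswitch`.
    , (λ (p , iso) → let (V , q′) = copy-switched {P = L 6} {W = aligning (crossing (L 4) i j s s′) p}
                                      x′ L₆-isTournament
                                      (copy-cong iso (copy-sub q (lookup p)))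
                     in inj₂ (unswitch {R = L 6} (V , _ , q′)))
    ]′ (L₄-crossing i j lt s s′)
    where
    i = label u
    j = label v
    s = normal u (e i)
    s′ = normal v (e j)
    q : Copy normal (crossing (L 4) i j s s′) (u VF.∷ v VF.∷ e)
    q = copy-crossing (λ eq → ℕₚ.<⇒≢ lt (cong toℕ eq)) wrong

InD5⇒L6-blowup : ∀ {n} {T : Rel n} → IsTournament T → InD 5 T → HasCopy T (L 6) → SwBlowup T (L 6)
InD5⇒L6-blowup {n} {T} t d (W , e , c) = result crossed?
  where
  X = switch T W
  x = switch-isTournament t W
  dX : InD 5 X
  dX = InD-switch {5} {T = T} t W d
  match : ∀ w → ∃₂ (Matches (L 6) (λ j → X w (e j)))
  -- Vertices of the copy match themselves and are treated apart, because `copy-cone`, which refutes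
  -- an unmatched row, needs a vertex outside the copy.
  match w = decide (any? λ i → e i Fin.≟ w)
    where
    bits = tabulate (λ j → X w (e j))
    decide : Dec (∃ λ i → e i ≡ w) → ∃₂ (Matches (L 6) (λ j → X w (e j)))
    decide (yes (i , refl)) = i , false , λ j _ → trans (arc c i j) (sym (Boolₚ.xor-identityʳ (L 6 i j)))
    decide (no fresh) =
      [ (λ (i , s , m) → i , s , Matches-cong {R = L 6} (Vecₚ.lookup∘tabulate (λ j → X w (e j))) m)
      , (λ (r , big) → contradiction dX (copy-exceeds big x
          (sub-isTournament {f = punchIn (suc r)} (Finₚ.punchIn-injective (suc r) _ _)
            (cone-isTournament L₆-isTournament _))
          (copy-sub
            (copy-cone x c (λ j eq → fresh (j , sym eq)) (λ j → sym (Vecₚ.lookup∘tabulate (λ j → X w (e j)) j)))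
            (punchIn (suc r)))))
      ]′ (L₆-matches bits)
  open Labels {R = L 6} {X = X} c match L₆-matchesItself
  x′ = switch-isTournament x flipped
  d′ : InD 5 normal
  d′ = InD-switch {5} {T = X} x flipped dX
  open Attached L₆-isTournament x′ normal-copy label (proj₁ ∘ own-e) adjacent
  large : ∀ i → ∃ λ js → (∀ a → i ≢ js a) × IsTournament (sub (L 6) js) × Exceeds 5 (triangle (L 6) js i)
  large i = lookup (others i) , proj₁ (others-valid i) , proj₂ (others-valid i) , L₆-triangle i
  result : Dec (∃₂ Crossed) → SwBlowup T (L 6)
  result (no none) = SwBlowup-unswitch {T = T} {L 6} W (flipped , uncrossed⇒blowup {5} d′ large none)
  result (yes (u , v , lt , wrong)) =
    [ (λ (xy , big) → contradiction d′ (copy-exceeds big x′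
        (sub-isTournament {f = deleting xy} (deleting-injective xy) (crossing-isTournament L₆-isTournament i j s s′))
        (copy-sub q (deleting xy))))
    , (λ big → contradiction d′ (copy-exceeds big x′ (crossing-isTournament L₆-isTournament i j s s′) q))
    ]′ (L₆-crossing i j lt s s′)
    where
    i = label u
    j = label v
    s = normal u (e i)
    s′ = normal v (e j)
    q : Copy normal (crossing (L 6) i j s s′) (u VF.∷ v VF.∷ e)
    q = copy-crossing (λ eq → ℕₚ.<⇒≢ lt (cong toℕ eq)) wrong

-- Switching to a dominating vertex

module Dominated {m} {T : Rel (suc (suc m))} (t : IsTournament T) where

  toward-zero : Fin (suc (suc m)) → Bool
  toward-zero w = T w zero

  X : Rel (suc (suc m))
  X = switch T toward-zero

  x : IsTournament X
  x = switch-isTournament t toward-zero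

  dominating : ∀ {v} → v ≢ zero → X zero v ≡ true
  dominating {v} v≢0 rewrite oneArc t zero v (v≢0 ∘ sym) | irrefl t zero with T v zero
  ... | true  = refl
  ... | false = refl

  no-arc-into-zero : ∀ v → X v zero ≡ false
  no-arc-into-zero zero    = irrefl x zero
  no-arc-into-zero (suc v) = arc-flip x (dominating λ ())

  Cyclic : Fin (suc (suc m)) → Fin (suc (suc m)) → Fin (suc (suc m)) → Set
  Cyclic u v w = X u v ≡ true × X v w ≡ true × X w u ≡ true

  cyclic? : Dec (∃ λ u → ∃₂ (Cyclic u))
  cyclic? = any? λ u → any? λ v → any? λ w →
    (X u v Bool.≟ true) ×-dec (X v w Bool.≟ true) ×-dec (X w u Bool.≟ true)

  acyclic⇒L2-blowup : ¬ (∃ λ u → ∃₂ (Cyclic u)) → SwBlowup T (L 2)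
  acyclic⇒L2-blowup none = toward-zero , labelling⇒blowup x (L 2) ℓ
    (λ { zero → suc zero , refl ; (suc zero) → zero , refl }) cross
    (λ {u} {v} {w} _ _ uv vw wu → none (u , v , w , uv , vw , wu))
    where
    -- The only arc of `L 2` goes from index 1 to index 0, so the dominating vertex alone forms
    -- block 1.
    ℓ : Fin (suc (suc m)) → Fin 2
    ℓ zero    = suc zero
    ℓ (suc _) = zero
    cross : ∀ u v → ℓ u ≢ ℓ v → X u v ≡ L 2 (ℓ u) (ℓ v)
    cross zero    zero    ne = contradiction refl ne
    cross zero    (suc v) _  = dominating λ ()
    cross (suc u) zero    _  = no-arc-into-zero (suc u)
    cross (suc u) (suc v) ne = contradiction refl ne

  -- Reversing the arcs at its last vertex turns `L 4` into a vertex dominating a cyclic triangle.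
  -- Vertex `zero` of `X` has no incoming arc, so it lies outside the given triangle.
  cyclic⇒L4-copy : (∃ λ u → ∃₂ (Cyclic u)) → HasCopy T (L 4)
  cyclic⇒L4-copy (u , v , w , uv , vw , wu) =
    HasCopy-unswitch {T = T} {L 4} toward-zero
      (proj₁ switched , _ , proj₂ switched)
    where
    ∅ : Rel 0
    ∅ ()
    diamond : Rel 4
    diamond = cone (cone (cone (cone ∅ VF.[]) (true VF.∷ VF.[])) (true VF.∷ false VF.∷ VF.[])) (λ _ → true)
    last : Fin 4 → Bool
    last i = does (i Fin.≟ # 3)
    diamond≗ : ∀ i j → diamond i j ≡ switch (L 4) last i j
    diamond≗ = from-yes (all? λ i → all? λ j → diamond i j Bool.≟ switch (L 4) last i j)
    distinct : ∀ {x y} → X x y ≡ true → x ≢ y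
    distinct xy refl = contradiction (trans (sym xy) (irrefl x _)) λ ()
    nonzero : ∀ {a b} → X a b ≡ true → b ≢ zero
    nonzero ab refl = contradiction (trans (sym ab) (no-arc-into-zero _)) λ ()
    nonzeros : ∀ i → (u VF.∷ v VF.∷ w VF.∷ VF.[]) i ≢ zero
    nonzeros zero             = nonzero wu
    nonzeros (suc zero)       = nonzero uv
    nonzeros (suc (suc zero)) = nonzero vw
    q : Copy X diamond (zero VF.∷ u VF.∷ v VF.∷ w VF.∷ VF.[])
    q = copy-cone x (copy-cone x (copy-cone x (copy-cone {P = ∅} {e = VF.[]} x (record { arc = λ () }) (λ ()) (λ ()))
          (λ { zero → distinct vw }) (λ { zero → vw }))
          (λ { zero → distinct uv ; (suc zero) → distinct wu ∘ sym }) (λ { zero → uv ; (suc zero) → arc-flip x wu }))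
          (λ i → nonzeros i ∘ sym) (λ i → dominating (nonzeros i))
    switched = copy-switched {P = L 4} {W = last} x L₄-isTournament (copy-cong diamond≗ q)

-- The classification

InD5⇒blowup : ∀ {n} {T : Rel n} → IsTournament T → 2 ≤ n → InD 5 T →
  SwBlowup T (L 2) ⊎ SwBlowup T (L 4) ⊎ SwBlowup T (L 6)
InD5⇒blowup {suc (suc n)} {T} t (ℕ.s≤s (ℕ.s≤s _)) d = result cyclic?
  where
  open Dominated t
  result : Dec (∃ λ u → ∃₂ (Cyclic u)) → SwBlowup T (L 2) ⊎ SwBlowup T (L 4) ⊎ SwBlowup T (L 6)
  result (no none) = inj₁ (acyclic⇒L2-blowup none)
  result (yes cyc) = inj₂ (Sum.map₂ (InD5⇒L6-blowup t d) (InD5⇒L4-blowup⊎L6-copy t d (cyclic⇒L4-copy cyc)))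

theorem3p12 : ∀ (n : ℕ) (T : Rel n) → IsTournament T → 2 ≤ n →
   (InD 1 T ⇔ SwBlowup T (L 2))
   × ((InD 3 T × ¬ InD 1 T) ⇔ SwBlowup T (L 4))
   × (InD 3 T ⇔ (SwBlowup T (L 2) ⊎ SwBlowup T (L 4)))
   × ((InD 5 T × ¬ InD 3 T) ⇔ SwBlowup T (L 6))
   × (InD 5 T ⇔ (SwBlowup T (L 2) ⊎ SwBlowup T (L 4) ⊎ SwBlowup T (L 6)))
theorem3p12 n T t 2≤n =
    -- Every forward direction starts from the three alternatives within `InD 5`. An unwanted one
    -- contradicts either a bound, since `L 4` and `L 6` have determinants 9 and 25, or the assumed
    -- non-membership in a smaller class.
    mk⇔ (λ d → [ (λ b → b) , [ (λ b → contradiction d (¬d₁ b)) , (λ b → contradiction (1⇒3 d) (¬d₃ b)) ]′ ]′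
             (blowup′ (3⇒5 (1⇒3 d))))
      d₁
  , mk⇔ (λ (d , ¬d) → [ (λ b → contradiction (d₁ b) ¬d) , [ (λ b → b) , (λ b → contradiction d (¬d₃ b)) ]′ ]′
                    (blowup′ (3⇒5 d)))
      (λ b → d₃ b , ¬d₁ b)
  , mk⇔ (λ d → [ inj₁ , [ inj₂ , (λ b → contradiction d (¬d₃ b)) ]′ ]′ (blowup′ (3⇒5 d)))
      [ 1⇒3 ∘ d₁ , d₃ ]′
  , mk⇔ (λ (d , ¬d) → [ (λ b → contradiction (1⇒3 (d₁ b)) ¬d) , [ (λ b → contradiction (d₃ b) ¬d) , (λ b → b) ]′ ]′
                    (blowup′ d))
      (λ b → d₅ b , ¬d₃ b)
  , mk⇔ blowup′ [ 3⇒5 ∘ 1⇒3 ∘ d₁ , [ 3⇒5 ∘ d₃ , d₅ ]′ ]′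
  where
  blowup′ : InD 5 T → SwBlowup T (L 2) ⊎ SwBlowup T (L 4) ⊎ SwBlowup T (L 6)
  blowup′ = InD5⇒blowup t 2≤n
  1⇒3 : InD 1 T → InD 3 T
  1⇒3 = InD-mono {1} {3} {T = T} (ℕ.s≤s ℕ.z≤n)
  3⇒5 : InD 3 T → InD 5 T
  3⇒5 = InD-mono {3} {5} {T = T} (ℕ.s≤s (ℕ.s≤s (ℕ.s≤s ℕ.z≤n)))
  d₁ : SwBlowup T (L 2) → InD 1 T
  d₁ = SwBlowup⇒InD (L 2) L₂-irrefl {1} L₂-bounded t
  d₃ : SwBlowup T (L 4) → InD 3 T
  d₃ = SwBlowup⇒InD (L 4) (irrefl L₄-isTournament) {3} L₄-bounded t
  d₅ : SwBlowup T (L 6) → InD 5 T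
  d₅ = SwBlowup⇒InD (L 6) (irrefl L₆-isTournament) {5} L₆-bounded t
  ¬d₁ : SwBlowup T (L 4) → ¬ InD 1 T
  ¬d₁ = SwBlowup⇒¬InD {1} L₄-isTournament L₄-exceeds t
  ¬d₃ : SwBlowup T (L 6) → ¬ InD 3 T
  ¬d₃ = SwBlowup⇒¬InD {3} L₆-isTournament L₆-exceeds t
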